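{- Let $D_{ - }F(z)=F(z)-F(z-1)$, applied coefficientwise. Then \[ D_{ - }H_B(z)=-\sum_{k=0}^{\infty}Y_{ -k}(z-1)^k\,H_B(z), \] equivalently $H_B(z+1)-H_B(z)=-\sum_{k\ge0}Y_{ -k}z^kH_B(z+1)$.
   Context: Normalized multiple Bernoulli polynomials: for integers $k\ge0$, $\zeta(-k|z)=-\frac{B_{k+1}(z)}{k+1}$ ($B_n(z)$ the Bernoulli polynomials, $B_n=B_n(0)$), and for $r\ge2$, $k_j\ge0$, $\zeta(-k_1,\ldots,-k_r|z)=-\frac{1}{k_r+1}\zeta(-k_1,\ldots,-k_{r-2},-k_{r-1}-k_r-1|z)-\frac12\zeta(-k_1,\ldots,-k_{r-2},-k_{r-1}-k_r|z)+\sum_{q=1}^{k_r}(-k_r)_q\frac{B_{q+1}}{(q+1)!}\zeta(-k_1,\ldots,-k_{r-2},-k_{r-1}-k_r+q|z)$, with $(a)_q=a(a+1)\cdots(a+q-1)$; the depth-zero (empty tuple) value is $1$. Let $\{Y_{ -n}\}_{n\ge0}$ be non-commuting formal variables and \[ H_B(z)=\sum\zeta(-n_1,\ldots,-n_r|z)\,Y_{ -n_1}\cdots Y_{ -n_r}, \] the sum over all tuples (including the empty tuple, $r=0$) of non-positive integers. -}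

module Defs where

open import Data.Fin.Base using (Fin; toℕ)
open import Data.Fin.Properties using (toℕ<n)
open import Data.Integer.Base using (+_)
open import Data.List.Base
  using (List; []; _∷_; map; foldr; applyUpTo; tabulate; zipWith; inits; tails; reverse)
open import Data.List.Properties using (tabulate-cong)
open import Data.Nat.Base as ℕ using (ℕ; zero; suc; _!; _≤_; _∸_; _⊔_)
open import Data.Nat.Combinatorics using (_C_)
open import Data.Nat.Induction using (<-rec; <-wellFounded)
import Data.Nat.Properties as ℕ
open import Data.Product.Base using (∃-syntax; _,_)
open import Data.Rational.Base as ℚ using (ℚ; 0ℚ; 1ℚ; ½)
open import Induction.WellFounded using (module FixPoint)
open import Relation.Binary.PropositionalEquality
  using (_≡_; cong; sym; trans)
open import Relation.Nullary.Decidable.Core using (yes; no)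

infix  4 _≈ᵖ_ _≋_
infixl 6 _+ᵖ_ _-ᵖ_ _-ˢ_
infixl 7 _*ᵖ_ _·_
infixr 7 _•_
infix  8 -ˢ_
infixl 8 _^ᵖ_
infixl 9 _⟨_⟩ᵖ _⟨_⟩

-- Polynomials in z as coefficient lists, constant term first.  Trailing zeros are allowed, so
-- polynomials are compared by _≈ᵖ_ and not by _≡_.
Poly : Set
Poly = List ℚ

coeff : Poly → ℕ → ℚ
coeff []      _       = 0ℚ
coeff (a ∷ _) zero    = a
coeff (_ ∷ p) (suc i) = coeff p i

_≈ᵖ_ : Poly → Poly → Set
p ≈ᵖ q = ∀ i → coeff p i ≡ coeff q i

con : ℚ → Poly
con a = a ∷ []

0ᵖ 1ᵖ z : Poly
0ᵖ = []
1ᵖ = con 1ℚ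
z  = 0ℚ ∷ 1ℚ ∷ []

_+ᵖ_ : Poly → Poly → Poly
[]      +ᵖ q       = q
(a ∷ p) +ᵖ []      = a ∷ p
(a ∷ p) +ᵖ (b ∷ q) = a ℚ.+ b ∷ p +ᵖ q

_•_ : ℚ → Poly → Poly
a • p = map (a ℚ.*_) p

_-ᵖ_ : Poly → Poly → Poly
p -ᵖ q = p +ᵖ (ℚ.- 1ℚ) • q

_*ᵖ_ : Poly → Poly → Poly
[]      *ᵖ q = []
(a ∷ p) *ᵖ q = a • q +ᵖ (0ℚ ∷ p *ᵖ q)

_^ᵖ_ : Poly → ℕ → Poly
p ^ᵖ zero  = 1ᵖ
p ^ᵖ suc n = p *ᵖ p ^ᵖ n

sumᵖ : List Poly → Poly
sumᵖ = foldr _+ᵖ_ 0ᵖ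

-- Substitution of q for z in p.
_⟨_⟩ᵖ : Poly → Poly → Poly
[]      ⟨ q ⟩ᵖ = []
(a ∷ p) ⟨ q ⟩ᵖ = con a +ᵖ q *ᵖ p ⟨ q ⟩ᵖ

eval : Poly → ℚ → ℚ
eval []      x = 0ℚ
eval (a ∷ p) x = a ℚ.+ x ℚ.* eval p x

fromℕ : ℕ → ℚ
fromℕ n = + n ℚ./ 1

1/1+_ : ℕ → ℚ
1/1+ n = + 1 ℚ./ suc n

1/_! : ℕ → ℚ
1/ n ! = (+ 1 ℚ./ (n !)) ⦃ n ℕ.!≢0 ⦄

-- Multiplying  ∑ₙ Bₙ(z) tⁿ/n! = t e^{zt} / (e^t - 1)  by (e^t - 1)/t and
-- comparing the coefficients of tⁿ/n! gives
--   ∑_{k=0}^{n} C(n+1,k) Bₖ(z) / (n+1) = zⁿ,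
-- which is solved for its k = n term Bₙ(z).
bernoulliStep : (n : ℕ) → (∀ {k} → k ℕ.< n → Poly) → Poly
bernoulliStep n B =
  z ^ᵖ n -ᵖ (1/1+ n) • sumᵖ (tabulate λ (i : Fin n) →
    fromℕ (suc n C toℕ i) • B (toℕ<n i))

bernoulliPoly : ℕ → Poly
bernoulliPoly = <-rec (λ _ → Poly) bernoulliStep

bernoulli : ℕ → ℚ
bernoulli n = eval (bernoulliPoly n) 0ℚ

bernoulliPoly-unfold : ∀ n → bernoulliPoly n ≡
  z ^ᵖ n -ᵖ (1/1+ n) • sumᵖ (tabulate λ (i : Fin n) →
    fromℕ (suc n C toℕ i) • bernoulliPoly (toℕ i))
bernoulliPoly-unfold n =
  FixPoint.unfold-wfRec <-wellFounded (λ _ → Poly) bernoulliStep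
    (λ m eq → cong (λ ps → z ^ᵖ m -ᵖ (1/1+ m) • sumᵖ ps)
      (tabulate-cong λ i → cong (fromℕ (suc m C toℕ i) •_) (eq (toℕ<n i))))
    {x = n}

rising : ℚ → ℕ → ℚ
rising a zero    = 1ℚ
rising a (suc q) = rising a q ℚ.* (a ℚ.+ fromℕ q)

-- zetaʳ k_r (k_{r-1} ∷ ⋯ ∷ k₁ ∷ []) = ζ(-k₁,…,-k_r|z).
-- The summation variable is q - 1; as q ≤ k_r, the truncated subtraction
-- in k_{r-1} + k_r ∸ q is exact.
zetaʳ : ℕ → List ℕ → Poly
zetaʳ k []       = (ℚ.- (1/1+ k)) • bernoulliPoly (suc k)
zetaʳ k (j ∷ ks) =
      (ℚ.- (1/1+ k)) • zetaʳ (j ℕ.+ k ℕ.+ 1) ks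
  +ᵖ (ℚ.- ½) • zetaʳ (j ℕ.+ k) ks
  +ᵖ sumᵖ (applyUpTo (λ q-1 → let q = suc q-1 in
       (rising (ℚ.- fromℕ k) q ℚ.* bernoulli (suc q) ℚ.* 1/ suc q !)
         • zetaʳ (j ℕ.+ k ∸ q) ks) k)

-- zeta (k₁ ∷ ⋯ ∷ k_r ∷ []) = ζ(-k₁,…,-k_r|z)
zeta : List ℕ → Poly
zeta ks = fromReversed (reverse ks)
  module Zeta where
  fromReversed : List ℕ → Poly
  fromReversed []       = 1ᵖ
  fromReversed (k ∷ ks) = zetaʳ k ks

-- A series over ℚ[z] in the non-commuting variables Y₀, Y₋₁, Y₋₂, … is its
-- coefficient function; the word n₁ ∷ ⋯ ∷ n_r ∷ [] stands
-- for the monomial Y_{-n₁}⋯Y_{-n_r}.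
Series : Set
Series = List ℕ → Poly

_≋_ : Series → Series → Set
F ≋ G = ∀ w → F w ≈ᵖ G w

_-ˢ_ : Series → Series → Series
(F -ˢ G) w = F w -ᵖ G w

-ˢ_ : Series → Series
(-ˢ F) w = (ℚ.- 1ℚ) • F w

_·_ : Series → Series → Series
(F · G) w = sumᵖ (zipWith (λ u v → F u *ᵖ G v) (inits w) (tails w))

conˢ : Poly → Series
conˢ p []      = p
conˢ p (_ ∷ _) = 0ᵖ

Y : ℕ → Series
Y k []          = 0ᵖ
Y k (n ∷ [])    with n ℕ.≟ k
... | yes _ = 1ᵖ
... | no  _ = 0ᵖ
Y k (_ ∷ _ ∷ _) = 0ᵖ

_⟨_⟩ : Series → Poly → Series
(F ⟨ q ⟩) w = F w ⟨ q ⟩ᵖ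

D₋ : Series → Series
D₋ F = F -ˢ F ⟨ z -ᵖ 1ᵖ ⟩

-- IsSum F S says that ∑_{k≥0} F k = S: at each word the coefficients of
-- the partial sums are eventually constant, with value that of S.
IsSum : (ℕ → Series) → Series → Set
IsSum F S = ∀ w → ∃[ N ] (∀ M → N ≤ M → sumᵖ (applyUpTo (λ k → F k w) M) ≈ᵖ S w)

IsSum-unique : ∀ {F S T} → IsSum F S → IsSum F T → S ≋ T
IsSum-unique s t w i with s w | t w
... | N , p | N′ , q =
  trans (sym (p (N ⊔ N′) (ℕ.m≤m⊔n N N′) i)) (q (N ⊔ N′) (ℕ.m≤n⊔m N N′) i)

H_B : Series
H_B = zeta

{-# OPTIONS --safe #-}

-- At a word of length at least 3 the recursion for ζ only touches the last two letters, so the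
-- difference equation reduces to words of length 1 and 2.  For these, write β(x) for the sequence
-- Bₙ(x)/n!, exp(x) for xⁿ/n! and ⊛ for the Cauchy product.  The recursion of Bₙ(x) says
-- β(x) ⊛ E = exp(x) with Eₙ = 1/(n+1)!; as E is cancellable this yields
--   β(x + y) = β(x) ⊛ exp(y),   β(x + 1)ₙ₊₁ = β(x)ₙ₊₁ + exp(x)ₙ,   β(1)ₙ = (-1)ⁿ β(0)ₙ,
-- hence β(x + 1) = ((-1)ⁿ β(0)ₙ) ⊛ exp(x), which is the recursion for ζ at length 2.
-- All identities are checked on values at rational points; these determine a polynomial.
module Submission where

open import Defs hiding (con)
open import Algebra.Bundles using (CommutativeRing)
open import Data.Fin.Base using (toℕ)
open import Data.Integer.Base as ℤ using (+_)
import Data.Integer.Properties as ℤ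
open import Data.List.Base
  using (List; []; _∷_; _∷ʳ_; map; length; applyUpTo; tabulate; zipWith; inits; tails; reverse)
open import Data.List.Properties using (map-id; unfold-reverse; zipWith-map)
open import Data.Nat.Base as ℕ using (ℕ; zero; suc; _!; _∸_; _≤_; _<_; z≤n; s≤s)
open import Data.Nat.Combinatorics using (_C_; nCk≡n!/k![n-k]!; k![n∸k]!∣n!)
open import Data.Nat.DivMod using (m/n*n≡m)
import Data.Nat.Properties as ℕ
open import Data.Product.Base using (_×_; ∃-syntax; _,_)
open import Data.Rational.Base as ℚ using (ℚ; 0ℚ; 1ℚ; ½; _+_; _*_; -_; _-_)
import Data.Rational.Properties as ℚ
open import Data.Rational.Solver using (module +-*-Solver)
open import Data.Rational.Unnormalised.Base using (mkℚᵘ; *≡*; 1ℚᵘ)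
import Data.Rational.Unnormalised.Properties as ℚᵘ
open import Function.Base using (_∘_; _$_; id)
open import Relation.Binary.PropositionalEquality
open import Relation.Nullary using (yes; no; contradiction)
open import Algebra.Properties.Group ℚ.+-0-group
  using (x∙y⁻¹≈ε⇒x≈y; x≈y⇒x∙y⁻¹≈ε) renaming (∙-cancelˡ to +-cancelˡ)
open import Algebra.Properties.Semiring.Exp (CommutativeRing.semiring ℚ.+-*-commutativeRing)
  using (_^_; ^-homo-*)
open +-*-Solver
open ≡-Reasoning

-- Factorials in ℚ

-- With powers x^{k-q} in place of the shorter ζ, this sum is -k! times the coefficient k+1 of a
-- Cauchy product with exp(x). The sign (-1)^q inside (-k)_q forces the other factor to be
-- (-1)ⁱBᵢ/i! instead of Bᵢ/i!. By reflection this factor is Bᵢ(1)/i!, so the product produces ζ at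
-- x + 1. This is why the right-hand side of the theorem carries H_B one step ahead of the powers
-- that multiply it. The letter to be split off is the first one, at the end opposite to where the
-- recursion works. The step from length 1 to length 2 is the only one in which the recursion
-- changes this letter. There the powers x^m contributed by length 1 all contain x^{n₁}, which
-- factors out and leaves exactly the sum above.

/-*-/ : ∀ a m b n → (+ a ℚ./ suc m) * (+ b ℚ./ suc n) ≡ + (a ℕ.* b) ℚ./ (suc m ℕ.* suc n)
/-*-/ a m b n = ℚ.toℚᵘ-injective
  (ℚᵘ.≃-trans (ℚ.toℚᵘ-homo-* (+ a ℚ./ suc m) (+ b ℚ./ suc n))
  (ℚᵘ.≃-trans (ℚᵘ.*-cong (ℚ.toℚᵘ-fromℚᵘ (mkℚᵘ (+ a) m)) (ℚ.toℚᵘ-fromℚᵘ (mkℚᵘ (+ b) n)))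
  (ℚᵘ.≃-trans (ℚᵘ.≃-reflexive (cong (λ c → mkℚᵘ c _) (sym (ℤ.pos-* a b))))
    (ℚᵘ.≃-sym (ℚ.toℚᵘ-fromℚᵘ (mkℚᵘ (+ (a ℕ.* b)) _))))))

fromℕ-* : ∀ m n → fromℕ (m ℕ.* n) ≡ fromℕ m * fromℕ n
fromℕ-* m n = sym (/-*-/ m 0 n 0)

fromℕ-suc : ∀ n → fromℕ (suc n) ≡ 1ℚ + fromℕ n
fromℕ-suc n = ℚ.toℚᵘ-injective
  (ℚᵘ.≃-trans (ℚ.toℚᵘ-fromℚᵘ (mkℚᵘ (+ suc n) 0))
  (ℚᵘ.≃-sym
    (ℚᵘ.≃-trans (ℚ.toℚᵘ-homo-+ 1ℚ (fromℕ n))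
    (ℚᵘ.≃-trans (ℚᵘ.+-congʳ 1ℚᵘ (ℚ.toℚᵘ-fromℚᵘ (mkℚᵘ (+ n) 0)))
      (*≡* (cong (λ k → (+ 1 ℤ.+ k) ℤ.* + 1) (ℤ.*-identityʳ (+ n))))))))

fromℕ-+ : ∀ m n → fromℕ (m ℕ.+ n) ≡ fromℕ m + fromℕ n
fromℕ-+ zero    n = sym (ℚ.+-identityˡ (fromℕ n))
fromℕ-+ (suc m) n = begin
  fromℕ (suc (m ℕ.+ n))    ≡⟨ fromℕ-suc (m ℕ.+ n) ⟩
  1ℚ + fromℕ (m ℕ.+ n)     ≡⟨ cong (λ a → 1ℚ + a) (fromℕ-+ m n) ⟩
  1ℚ + (fromℕ m + fromℕ n) ≡⟨ ℚ.+-assoc 1ℚ (fromℕ m) (fromℕ n) ⟨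
  1ℚ + fromℕ m + fromℕ n   ≡⟨ cong (_+ fromℕ n) (fromℕ-suc m) ⟨
  fromℕ (suc m) + fromℕ n  ∎

fromℕ-inverse : ∀ n .⦃ _ : ℕ.NonZero n ⦄ → fromℕ n * (+ 1 ℚ./ n) ≡ 1ℚ
fromℕ-inverse (suc n) = begin
  fromℕ (suc n) * 1/1+ n                 ≡⟨ /-*-/ (suc n) 0 1 n ⟩
  + (suc n ℕ.* 1) ℚ./ (1 ℕ.* suc n)      ≡⟨ ℚ.fromℚᵘ-cong {mkℚᵘ (+ (suc n ℕ.* 1)) (n ℕ.+ 0)} {mkℚᵘ (+ 1) 0} (*≡* (cong +_ eq)) ⟩
  1ℚ                                     ∎
  where
  eq : suc n ℕ.* 1 ℕ.* 1 ≡ 1 ℕ.* (1 ℕ.* suc n)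
  eq = trans (trans (ℕ.*-identityʳ _) (ℕ.*-comm (suc n) 1)) (sym (ℕ.*-identityˡ _))

!-inverse : ∀ n → fromℕ (n !) * 1/ n ! ≡ 1ℚ
!-inverse n = fromℕ-inverse (n !) ⦃ n ℕ.!≢0 ⦄

inverse-unique : ∀ {a b c} → a * b ≡ 1ℚ → a * c ≡ 1ℚ → b ≡ c
inverse-unique {a} {b} {c} ab ac = begin
  b             ≡⟨ ℚ.*-identityˡ b ⟨
  1ℚ * b        ≡⟨ cong (_* b) ac ⟨
  a * c * b     ≡⟨ solve 3 (λ a b c → a :* c :* b := a :* b :* c) refl a b c ⟩
  a * b * c     ≡⟨ cong (_* c) ab ⟩
  1ℚ * c        ≡⟨ ℚ.*-identityˡ c ⟩
  c             ∎

1/!-suc : ∀ n → 1/ suc n ! ≡ 1/1+ n * 1/ n !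
1/!-suc n = inverse-unique {fromℕ (suc n !)} (!-inverse (suc n)) $ begin
  fromℕ (suc n !) * (1/1+ n * 1/ n !)
    ≡⟨ cong (_* (1/1+ n * 1/ n !)) (fromℕ-* (suc n) (n !)) ⟩
  fromℕ (suc n) * fromℕ (n !) * (1/1+ n * 1/ n !)
    ≡⟨ solve 4 (λ a b c d → a :* b :* (c :* d) := (a :* c) :* (b :* d)) refl
         (fromℕ (suc n)) (fromℕ (n !)) (1/1+ n) (1/ n !) ⟩
  fromℕ (suc n) * 1/1+ n * (fromℕ (n !) * 1/ n !)
    ≡⟨ cong₂ _*_ (fromℕ-inverse (suc n)) (!-inverse n) ⟩
  1ℚ * 1ℚ ≡⟨⟩
  1ℚ ∎

fromℕ-∸ : ∀ {m n} → n ≤ m → fromℕ (m ∸ n) ≡ fromℕ m - fromℕ n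
fromℕ-∸ {m} {n} n≤m = begin
  fromℕ (m ∸ n)                       ≡⟨ solve 2 (λ a b → a := a :+ b :- b) refl (fromℕ (m ∸ n)) (fromℕ n) ⟩
  fromℕ (m ∸ n) + fromℕ n - fromℕ n   ≡⟨ cong (_- fromℕ n) (fromℕ-+ (m ∸ n) n) ⟨
  fromℕ (m ∸ n ℕ.+ n) - fromℕ n       ≡⟨ cong (λ k → fromℕ k - fromℕ n) (ℕ.m∸n+n≡m n≤m) ⟩
  fromℕ m - fromℕ n                   ∎

-- This turns the binomial recursion for Bₙ(x) into a Cauchy product of sequences divided by
-- factorials.
C-factorials : ∀ {n k} → k ≤ n → fromℕ (n C k) * 1/ n ! ≡ 1/ k ! * 1/ (n ∸ k) !
C-factorials {n} {k} k≤n = begin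
  fromℕ (n C k) * 1/ n !
    ≡⟨ cong (_* 1/ n !) (begin
         c                                     ≡⟨ solve 1 (λ c → c := c :* (con 1ℚ :* con 1ℚ)) refl c ⟩
         c * (1ℚ * 1ℚ)                         ≡⟨ cong (c *_) (cong₂ _*_ (!-inverse k) (!-inverse (n ∸ k))) ⟨
         c * (a * 1/ k ! * (b * 1/ (n ∸ k) !)) ≡⟨ solve 5 (λ c a a′ b b′ → c :* (a :* a′ :* (b :* b′)) := c :* (a :* b) :* (a′ :* b′))
                                                  refl c a (1/ k !) b (1/ (n ∸ k) !) ⟩
         c * (a * b) * (1/ k ! * 1/ (n ∸ k) !) ≡⟨ cong (_* (1/ k ! * 1/ (n ∸ k) !)) eq ⟩
         fromℕ (n !) * (1/ k ! * 1/ (n ∸ k) !) ∎) ⟩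
  fromℕ (n !) * (1/ k ! * 1/ (n ∸ k) !) * 1/ n !
    ≡⟨ solve 3 (λ a b c → a :* b :* c := a :* c :* b) refl (fromℕ (n !)) (1/ k ! * 1/ (n ∸ k) !) (1/ n !) ⟩
  fromℕ (n !) * 1/ n ! * (1/ k ! * 1/ (n ∸ k) !)
    ≡⟨ cong (_* (1/ k ! * 1/ (n ∸ k) !)) (!-inverse n) ⟩
  1ℚ * (1/ k ! * 1/ (n ∸ k) !)
    ≡⟨ ℚ.*-identityˡ _ ⟩
  1/ k ! * 1/ (n ∸ k) ! ∎
  where
  a = fromℕ (k !)
  b = fromℕ ((n ∸ k) !)
  c = fromℕ (n C k)
  instance _ = ℕ._!*_!≢0 k (n ∸ k)
  eq : c * (a * b) ≡ fromℕ (n !)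
  eq = begin
    c * (a * b)                                  ≡⟨ cong (c *_) (fromℕ-* (k !) ((n ∸ k) !)) ⟨
    c * fromℕ (k ! ℕ.* (n ∸ k) !)                ≡⟨ fromℕ-* (n C k) (k ! ℕ.* (n ∸ k) !) ⟨
    fromℕ ((n C k) ℕ.* (k ! ℕ.* (n ∸ k) !))
      -- Natural division truncates; k!(n-k)! divides n!, so the quotient is exact.
      ≡⟨ cong fromℕ (trans (cong (ℕ._* (k ! ℕ.* (n ∸ k) !)) (nCk≡n!/k![n-k]! k≤n)) (m/n*n≡m (k![n∸k]!∣n! k≤n))) ⟩
    fromℕ (n !)                                  ∎

-- Sums and Cauchy products

∑ : ℕ → (ℕ → ℚ) → ℚ
∑ zero    f = 0ℚ
∑ (suc n) f = f 0 + ∑ n (f ∘ suc)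

∑-cong : ∀ n {f g} → (∀ i → i < n → f i ≡ g i) → ∑ n f ≡ ∑ n g
∑-cong zero    f≡g = refl
∑-cong (suc n) f≡g = cong₂ _+_ (f≡g 0 (s≤s z≤n)) (∑-cong n λ i i<n → f≡g (suc i) (s≤s i<n))

∑-+ : ∀ n f g → ∑ n (λ i → f i + g i) ≡ ∑ n f + ∑ n g
∑-+ zero    f g = refl
∑-+ (suc n) f g = begin
  f 0 + g 0 + ∑ n (λ i → f (suc i) + g (suc i))  ≡⟨ cong (λ a → f 0 + g 0 + a) (∑-+ n (f ∘ suc) (g ∘ suc)) ⟩
  f 0 + g 0 + (∑ n (f ∘ suc) + ∑ n (g ∘ suc))
    ≡⟨ solve 4 (λ a b c d → a :+ b :+ (c :+ d) := a :+ c :+ (b :+ d)) refl (f 0) (g 0) (∑ n (f ∘ suc)) (∑ n (g ∘ suc)) ⟩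
  f 0 + ∑ n (f ∘ suc) + (g 0 + ∑ n (g ∘ suc))    ∎

∑-* : ∀ n a f → ∑ n (λ i → a * f i) ≡ a * ∑ n f
∑-* zero    a f = sym (ℚ.*-zeroʳ a)
∑-* (suc n) a f = trans (cong (λ b → a * f 0 + b) (∑-* n a (f ∘ suc))) (sym (ℚ.*-distribˡ-+ a (f 0) _))

∑-snoc : ∀ n f → ∑ (suc n) f ≡ ∑ n f + f n
∑-snoc zero    f = ℚ.+-comm (f 0) 0ℚ
∑-snoc (suc n) f = trans (cong (λ a → f 0 + a) (∑-snoc n (f ∘ suc))) (sym (ℚ.+-assoc (f 0) _ (f (suc n))))

∑-zero : ∀ M {f} → (∀ i → f i ≡ 0ℚ) → ∑ M f ≡ 0ℚ
∑-zero zero    f≡0 = refl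
∑-zero (suc M) f≡0 = cong₂ _+_ (f≡0 0) (∑-zero M (f≡0 ∘ suc))

∑-single : ∀ M n f → n < M → (∀ i → i ≢ n → f i ≡ 0ℚ) → ∑ M f ≡ f n
∑-single (suc M) zero    f _         f≡0 =
  trans (cong (λ a → f 0 + a) (∑-zero M (λ i → f≡0 (suc i) λ ()))) (ℚ.+-identityʳ (f 0))
∑-single (suc M) (suc n) f (s≤s n<M) f≡0 = trans
  (cong₂ _+_ (f≡0 0 λ ()) (∑-single M n (f ∘ suc) n<M λ i i≢n → f≡0 (suc i) (i≢n ∘ ℕ.suc-injective)))
  (ℚ.+-identityˡ (f (suc n)))

infixl 7 _⊛_
-- Recursion on the index with a shift of the left factor avoids truncated subtraction, so the ring
-- laws follow by induction with the left factor generalised. `⊛-∑` recovers the usual sum.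
_⊛_ : (ℕ → ℚ) → (ℕ → ℚ) → ℕ → ℚ
(f ⊛ g) zero    = f 0 * g 0
(f ⊛ g) (suc n) = f 0 * g (suc n) + (f ∘ suc ⊛ g) n

⊛-∑ : ∀ f g n → (f ⊛ g) n ≡ ∑ (suc n) (λ i → f i * g (n ∸ i))
⊛-∑ f g zero    = sym (ℚ.+-identityʳ _)
⊛-∑ f g (suc n) = cong (λ a → f 0 * g (suc n) + a) (⊛-∑ (f ∘ suc) g n)

⊛-cong : ∀ {f f′ g g′} → f ≗ f′ → g ≗ g′ → f ⊛ g ≗ f′ ⊛ g′
⊛-cong p q zero    = cong₂ _*_ (p 0) (q 0)
⊛-cong p q (suc n) = cong₂ _+_ (cong₂ _*_ (p 0) (q (suc n))) (⊛-cong (p ∘ suc) q n)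

⊛-zeroˡ : ∀ {f} g → (∀ n → f n ≡ 0ℚ) → ∀ n → (f ⊛ g) n ≡ 0ℚ
⊛-zeroˡ g p zero    = trans (cong (_* g 0) (p 0)) (ℚ.*-zeroˡ (g 0))
⊛-zeroˡ g p (suc n) = cong₂ _+_ (trans (cong (_* g (suc n)) (p 0)) (ℚ.*-zeroˡ (g (suc n)))) (⊛-zeroˡ g (p ∘ suc) n)

⊛-+ˡ : ∀ f f′ g n → ((λ i → f i + f′ i) ⊛ g) n ≡ (f ⊛ g) n + (f′ ⊛ g) n
⊛-+ˡ f f′ g zero    = ℚ.*-distribʳ-+ (g 0) (f 0) (f′ 0)
⊛-+ˡ f f′ g (suc n) = begin
  (f 0 + f′ 0) * c + ((λ i → f (suc i) + f′ (suc i)) ⊛ g) n ≡⟨ cong (λ a → (f 0 + f′ 0) * c + a) (⊛-+ˡ (f ∘ suc) (f′ ∘ suc) g n) ⟩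
  (f 0 + f′ 0) * c + (s + t)
    ≡⟨ solve 5 (λ a b c s t → (a :+ b) :* c :+ (s :+ t) := a :* c :+ s :+ (b :* c :+ t)) refl (f 0) (f′ 0) c s t ⟩
  f 0 * c + s + (f′ 0 * c + t) ∎
  where
  c = g (suc n)
  s = (f ∘ suc ⊛ g) n
  t = (f′ ∘ suc ⊛ g) n

⊛-*ˡ : ∀ a f g n → ((λ i → a * f i) ⊛ g) n ≡ a * (f ⊛ g) n
⊛-*ˡ a f g zero    = ℚ.*-assoc a (f 0) (g 0)
⊛-*ˡ a f g (suc n) = begin
  a * f 0 * g (suc n) + ((λ i → a * f (suc i)) ⊛ g) n ≡⟨ cong (λ b → a * f 0 * g (suc n) + b) (⊛-*ˡ a (f ∘ suc) g n) ⟩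
  a * f 0 * g (suc n) + a * (f ∘ suc ⊛ g) n
    ≡⟨ solve 4 (λ a b c d → a :* b :* c :+ a :* d := a :* (b :* c :+ d)) refl a (f 0) (g (suc n)) ((f ∘ suc ⊛ g) n) ⟩
  a * (f 0 * g (suc n) + (f ∘ suc ⊛ g) n) ∎

-- The definition shifts the left factor; this is the same expansion for the right factor, as
-- commutativity and cancellation require.
⊛-suc : ∀ f g n → (f ⊛ g) (suc n) ≡ f (suc n) * g 0 + (f ⊛ g ∘ suc) n
⊛-suc f g zero    = ℚ.+-comm (f 0 * g 1) (f 1 * g 0)
⊛-suc f g (suc n) = begin
  a + (f ∘ suc ⊛ g) (suc n)   ≡⟨ cong (λ x → a + x) (⊛-suc (f ∘ suc) g n) ⟩
  a + (b + c)                 ≡⟨ solve 3 (λ a b c → a :+ (b :+ c) := b :+ (a :+ c)) refl a b c ⟩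
  b + (a + c)                 ∎
  where
  a = f 0 * g (suc (suc n))
  b = f (suc (suc n)) * g 0
  c = (f ∘ suc ⊛ g ∘ suc) n

⊛-comm : ∀ f g → f ⊛ g ≗ g ⊛ f
⊛-comm f g zero    = ℚ.*-comm (f 0) (g 0)
⊛-comm f g (suc n) = begin
  f 0 * g (suc n) + (f ∘ suc ⊛ g) n ≡⟨ cong₂ _+_ (ℚ.*-comm (f 0) (g (suc n))) (⊛-comm (f ∘ suc) g n) ⟩
  g (suc n) * f 0 + (g ⊛ f ∘ suc) n ≡⟨ ⊛-suc g f n ⟨
  (g ⊛ f) (suc n)                   ∎

⊛-assoc : ∀ f g h → f ⊛ g ⊛ h ≗ f ⊛ (g ⊛ h)
⊛-assoc f g h zero    = ℚ.*-assoc (f 0) (g 0) (h 0)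
⊛-assoc f g h (suc n) = begin
  f 0 * g 0 * c + ((λ i → f 0 * g (suc i) + (f ∘ suc ⊛ g) i) ⊛ h) n
    ≡⟨ cong (λ x → f 0 * g 0 * c + x) (begin
         ((λ i → f 0 * g (suc i) + (f ∘ suc ⊛ g) i) ⊛ h) n ≡⟨ ⊛-+ˡ (λ i → f 0 * g (suc i)) (f ∘ suc ⊛ g) h n ⟩
         ((λ i → f 0 * g (suc i)) ⊛ h) n + (f ∘ suc ⊛ g ⊛ h) n
           ≡⟨ cong₂ _+_ (⊛-*ˡ (f 0) (g ∘ suc) h n) (⊛-assoc (f ∘ suc) g h n) ⟩
         f 0 * s + t ∎) ⟩
  f 0 * g 0 * c + (f 0 * s + t)
    ≡⟨ solve 5 (λ a b c s t → a :* b :* c :+ (a :* s :+ t) := a :* (b :* c :+ s) :+ t) refl (f 0) (g 0) c s t ⟩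
  f 0 * (g 0 * c + s) + t ∎
  where
  c = h (suc n)
  s = (g ∘ suc ⊛ h) n
  t = (f ∘ suc ⊛ (g ⊛ h)) n

-- Index 0 gives equal heads because `h 0` is 1. Removing their contribution leaves the same
-- hypothesis for the shifted sequences.
⊛-cancelˡ : ∀ h {f g} → h 0 ≡ 1ℚ → h ⊛ f ≗ h ⊛ g → f ≗ g
⊛-cancelˡ h {f} {g} h₀ p = go
  where
  f₀≡g₀ : f 0 ≡ g 0
  f₀≡g₀ = begin
    f 0        ≡⟨ ℚ.*-identityˡ (f 0) ⟨
    1ℚ * f 0   ≡⟨ cong (_* f 0) h₀ ⟨
    h 0 * f 0  ≡⟨ p 0 ⟩
    h 0 * g 0  ≡⟨ cong (_* g 0) h₀ ⟩
    1ℚ * g 0   ≡⟨ ℚ.*-identityˡ (g 0) ⟩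
    g 0        ∎
  p′ : h ⊛ f ∘ suc ≗ h ⊛ g ∘ suc
  p′ n = +-cancelˡ (h (suc n) * f 0) _ _ (begin
    h (suc n) * f 0 + (h ⊛ f ∘ suc) n ≡⟨ ⊛-suc h f n ⟨
    (h ⊛ f) (suc n)                   ≡⟨ p (suc n) ⟩
    (h ⊛ g) (suc n)                   ≡⟨ ⊛-suc h g n ⟩
    h (suc n) * g 0 + (h ⊛ g ∘ suc) n ≡⟨ cong (λ a → h (suc n) * a + (h ⊛ g ∘ suc) n) f₀≡g₀ ⟨
    h (suc n) * f 0 + (h ⊛ g ∘ suc) n ∎)
  go : f ≗ g
  go zero    = f₀≡g₀
  go (suc n) = ⊛-cancelˡ h h₀ p′ n

-- Formal derivatives of generating functions

∂ : (ℕ → ℚ) → ℕ → ℚ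
∂ f n = fromℕ (suc n) * f (suc n)

∂-suc : ∀ f n → ∂ f (suc n) ≡ f (suc (suc n)) + ∂ (f ∘ suc) n
∂-suc f n = trans (cong (_* f (suc (suc n))) (fromℕ-suc (suc n)))
  (solve 2 (λ a b → (con 1ℚ :+ a) :* b := b :+ a :* b) refl (fromℕ (suc n)) (f (suc (suc n))))

-- Leibniz rule. `∂-suc` writes a shifted derivative as a second shift plus the derivative of the
-- shift, so the induction hypothesis for `f ∘ suc` applies.
∂-⊛ : ∀ f g n → ∂ (f ⊛ g) n ≡ (∂ f ⊛ g) n + (f ⊛ ∂ g) n
∂-⊛ f g zero    = solve 5 (λ i a b c d → i :* (a :* b :+ c :* d) := i :* c :* d :+ a :* (i :* b)) refl
  (fromℕ 1) (f 0) (g 1) (f 1) (g 0)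
∂-⊛ f g (suc n) = begin
  ∂ (f ⊛ g) (suc n)
    ≡⟨ ∂-suc (f ⊛ g) n ⟩
  f 0 * b + (f 1 * c + u) + k * (f 0 * b + (f 1 * c + u))
    ≡⟨ solve 6 (λ f₀ f₁ b c u k → f₀ :* b :+ (f₁ :* c :+ u) :+ k :* (f₀ :* b :+ (f₁ :* c :+ u))
         := f₁ :* c :+ (u :+ k :* (f₁ :* c :+ u)) :+ f₀ :* ((con 1ℚ :+ k) :* b)) refl (f 0) (f 1) b c u k ⟩
  f 1 * c + (u + ∂ (f ∘ suc ⊛ g) n) + f 0 * ((1ℚ + k) * b)
    ≡⟨ cong₂ (λ x y → f 1 * c + (u + x) + f 0 * (y * b)) (∂-⊛ (f ∘ suc) g n) (sym (fromℕ-suc (suc n))) ⟩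
  f 1 * c + (u + (v + w)) + f 0 * d
    ≡⟨ solve 6 (λ x y u v w e → x :* y :+ (u :+ (v :+ w)) :+ e := (con 1ℚ :* x) :* y :+ (u :+ v) :+ (e :+ w)) refl (f 1) c u v w (f 0 * d) ⟩
  -- `1ℚ * f 1` is `∂ f 0` by computation, the head of the product `∂ f ⊛ g`.
  1ℚ * f 1 * c + (u + v) + (f 0 * d + w)
    ≡⟨ cong (λ x → 1ℚ * f 1 * c + x + (f 0 * d + w)) (begin
         (f ∘ suc ∘ suc ⊛ g) n + (∂ (f ∘ suc) ⊛ g) n ≡⟨ ⊛-+ˡ (f ∘ suc ∘ suc) (∂ (f ∘ suc)) g n ⟨
         ((λ i → f (suc (suc i)) + ∂ (f ∘ suc) i) ⊛ g) n ≡⟨ ⊛-cong (λ i → sym (∂-suc f i)) (λ _ → refl) n ⟩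
         (∂ f ∘ suc ⊛ g) n ∎) ⟩
  (∂ f ⊛ g) (suc n) + (f ⊛ ∂ g) (suc n) ∎
  where
  b = g (suc (suc n))
  c = g (suc n)
  d = ∂ g (suc n)
  k = fromℕ (suc n)
  u = (f ∘ suc ∘ suc ⊛ g) n
  v = (∂ (f ∘ suc) ⊛ g) n
  w = (f ∘ suc ⊛ ∂ g) n

-- Uniqueness for the formal differential equation F′ = aF: each coefficient determines the next, as
-- n + 1 is invertible in ℚ.
∂-injective : ∀ {a f g} → f 0 ≡ g 0 → (∀ n → ∂ f n ≡ a * f n) → (∀ n → ∂ g n ≡ a * g n) → f ≗ g
∂-injective f₀≡g₀ p q zero = f₀≡g₀
∂-injective {a} {f} {g} f₀≡g₀ p q (suc n) = begin
  f (suc n)                                ≡⟨ lemma f ⟩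
  1/1+ n * ∂ f n                           ≡⟨ cong (1/1+ n *_) (p n) ⟩
  1/1+ n * (a * f n)                       ≡⟨ cong (λ b → 1/1+ n * (a * b)) (∂-injective {a} f₀≡g₀ p q n) ⟩
  1/1+ n * (a * g n)                       ≡⟨ cong (1/1+ n *_) (q n) ⟨
  1/1+ n * ∂ g n                           ≡⟨ lemma g ⟨
  g (suc n)                                ∎
  where
  lemma : ∀ h → h (suc n) ≡ 1/1+ n * ∂ h n
  lemma h = begin
    h (suc n)                                ≡⟨ ℚ.*-identityˡ _ ⟨
    1ℚ * h (suc n)                           ≡⟨ cong (_* h (suc n)) (fromℕ-inverse (suc n)) ⟨
    fromℕ (suc n) * 1/1+ n * h (suc n)       ≡⟨ solve 3 (λ a b c → a :* b :* c := b :* (a :* c)) refl (fromℕ (suc n)) (1/1+ n) (h (suc n)) ⟩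
    1/1+ n * ∂ h n                           ∎

-- Exponential sequences

exp : ℚ → ℕ → ℚ
exp x n = x ^ n * 1/ n !

∂-exp : ∀ x n → ∂ (exp x) n ≡ x * exp x n
∂-exp x n = begin
  fromℕ (suc n) * (x * x ^ n * 1/ suc n !)
    ≡⟨ cong (λ a → fromℕ (suc n) * (x * x ^ n * a)) (1/!-suc n) ⟩
  fromℕ (suc n) * (x * x ^ n * (1/1+ n * 1/ n !))
    ≡⟨ solve 5 (λ k x p i f → k :* (x :* p :* (i :* f)) := (k :* i) :* (x :* (p :* f))) refl (fromℕ (suc n)) x (x ^ n) (1/1+ n) (1/ n !) ⟩
  fromℕ (suc n) * 1/1+ n * (x * exp x n)
    ≡⟨ cong (_* (x * exp x n)) (fromℕ-inverse (suc n)) ⟩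
  1ℚ * (x * exp x n)
    ≡⟨ ℚ.*-identityˡ _ ⟩
  x * exp x n ∎

factorial-exp : ∀ n x → fromℕ (n !) * exp x n ≡ x ^ n
factorial-exp n x = begin
  fromℕ (n !) * (x ^ n * 1/ n !)  ≡⟨ solve 3 (λ a p b → a :* (p :* b) := a :* b :* p) refl (fromℕ (n !)) (x ^ n) (1/ n !) ⟩
  fromℕ (n !) * 1/ n ! * x ^ n    ≡⟨ cong (_* x ^ n) (!-inverse n) ⟩
  1ℚ * x ^ n                      ≡⟨ ℚ.*-identityˡ (x ^ n) ⟩
  x ^ n                           ∎

-- Both sides start at 1 and solve F′ = (x + y)F, the product by the Leibniz rule.
exp-+ : ∀ x y → exp x ⊛ exp y ≗ exp (x + y)
exp-+ x y = ∂-injective {x + y} refl ∂-exp⊛exp (∂-exp (x + y))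
  where
  ∂-exp⊛exp : ∀ n → ∂ (exp x ⊛ exp y) n ≡ (x + y) * (exp x ⊛ exp y) n
  ∂-exp⊛exp n = begin
    ∂ (exp x ⊛ exp y) n                               ≡⟨ ∂-⊛ (exp x) (exp y) n ⟩
    (∂ (exp x) ⊛ exp y) n + (exp x ⊛ ∂ (exp y)) n
      ≡⟨ cong₂ _+_ (⊛-cong (∂-exp x) (λ _ → refl) n) (trans (⊛-cong (λ _ → refl) (∂-exp y) n) (⊛-comm (exp x) _ n)) ⟩
    ((λ i → x * exp x i) ⊛ exp y) n + ((λ i → y * exp y i) ⊛ exp x) n
      ≡⟨ cong₂ _+_ (⊛-*ˡ x (exp x) (exp y) n) (trans (⊛-*ˡ y (exp y) (exp x) n) (cong (y *_) (⊛-comm (exp y) (exp x) n))) ⟩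
    x * (exp x ⊛ exp y) n + y * (exp x ⊛ exp y) n     ≡⟨ ℚ.*-distribʳ-+ _ x y ⟨
    (x + y) * (exp x ⊛ exp y) n                       ∎

exp-0 : ∀ n → exp 0ℚ (suc n) ≡ 0ℚ
exp-0 n = solve 2 (λ p f → con 0ℚ :* p :* f := con 0ℚ) refl (0ℚ ^ n) (1/ suc n !)

exp-0-⊛ : ∀ f → exp 0ℚ ⊛ f ≗ f
exp-0-⊛ f zero    = ℚ.*-identityˡ (f 0)
exp-0-⊛ f (suc n) = trans (cong₂ _+_ (ℚ.*-identityˡ (f (suc n))) (⊛-zeroˡ f exp-0 n)) (ℚ.+-identityʳ (f (suc n)))

1^ : ∀ n → 1ℚ ^ n ≡ 1ℚ
1^ zero    = refl
1^ (suc n) = trans (ℚ.*-identityˡ (1ℚ ^ n)) (1^ n)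

-- Alternating signs

sign : ℕ → ℚ
sign zero    = 1ℚ
sign (suc n) = - sign n

sign-square : ∀ n → sign n * sign n ≡ 1ℚ
sign-square zero    = refl
sign-square (suc n) = trans (solve 1 (λ s → (:- s) :* (:- s) := s :* s) refl (sign n)) (sign-square n)

-- The substitution t ↦ -t on generating functions, hence multiplicative for `⊛`.
alt : (ℕ → ℚ) → ℕ → ℚ
alt f n = sign n * f n

alt-suc : ∀ f n → alt f (suc n) ≡ - 1ℚ * alt (f ∘ suc) n
alt-suc f n = solve 2 (λ s a → (:- s) :* a := (:- con 1ℚ) :* (s :* a)) refl (sign n) (f (suc n))

alt-⊛ : ∀ f g → alt f ⊛ alt g ≗ alt (f ⊛ g)
alt-⊛ f g zero    = solve 2 (λ a b → con 1ℚ :* a :* (con 1ℚ :* b) := con 1ℚ :* (a :* b)) refl (f 0) (g 0)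
alt-⊛ f g (suc n) = begin
  1ℚ * f 0 * (- s * g (suc n)) + (alt f ∘ suc ⊛ alt g) n
    ≡⟨ cong (λ x → 1ℚ * f 0 * (- s * g (suc n)) + x) (begin
         (alt f ∘ suc ⊛ alt g) n                         ≡⟨ ⊛-cong (alt-suc f) (λ _ → refl) n ⟩
         ((λ i → - 1ℚ * alt (f ∘ suc) i) ⊛ alt g) n      ≡⟨ ⊛-*ˡ (- 1ℚ) (alt (f ∘ suc)) (alt g) n ⟩
         - 1ℚ * (alt (f ∘ suc) ⊛ alt g) n                ≡⟨ cong (- 1ℚ *_) (alt-⊛ (f ∘ suc) g n) ⟩
         - 1ℚ * (s * (f ∘ suc ⊛ g) n)                    ∎) ⟩
  1ℚ * f 0 * (- s * g (suc n)) + - 1ℚ * (s * (f ∘ suc ⊛ g) n)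
    ≡⟨ solve 4 (λ s a b c → con 1ℚ :* a :* ((:- s) :* b) :+ (:- con 1ℚ) :* (s :* c) := (:- s) :* (a :* b :+ c)) refl
         s (f 0) (g (suc n)) ((f ∘ suc ⊛ g) n) ⟩
  - s * (f 0 * g (suc n) + (f ∘ suc ⊛ g) n) ∎
  where s = sign n

exp-neg : ∀ n → exp (- 1ℚ) n ≡ alt (exp 1ℚ) n
exp-neg n = trans (cong (_* 1/ n !) (powers n)) (ℚ.*-assoc (sign n) (1ℚ ^ n) (1/ n !))
  where
  powers : ∀ n → (- 1ℚ) ^ n ≡ sign n * 1ℚ ^ n
  powers zero    = refl
  powers (suc n) = trans (cong (- 1ℚ *_) (powers n))
    (solve 2 (λ s p → (:- con 1ℚ) :* (s :* p) := (:- s) :* (con 1ℚ :* p)) refl (sign n) (1ℚ ^ n))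

-- Polynomials are determined by their values

eval-+ : ∀ p q x → eval (p +ᵖ q) x ≡ eval p x + eval q x
eval-+ []      q       x = sym (ℚ.+-identityˡ (eval q x))
eval-+ (a ∷ p) []      x = sym (ℚ.+-identityʳ _)
eval-+ (a ∷ p) (b ∷ q) x = trans (cong (λ c → a + b + x * c) (eval-+ p q x))
  (solve 5 (λ a b x u v → a :+ b :+ x :* (u :+ v) := a :+ x :* u :+ (b :+ x :* v)) refl a b x (eval p x) (eval q x))

eval-• : ∀ a p x → eval (a • p) x ≡ a * eval p x
eval-• a []      x = sym (ℚ.*-zeroʳ a)
eval-• a (b ∷ p) x = trans (cong (λ c → a * b + x * c) (eval-• a p x))
  (solve 4 (λ a b x u → a :* b :+ x :* (a :* u) := a :* (b :+ x :* u)) refl a b x (eval p x))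

eval-- : ∀ p q x → eval (p -ᵖ q) x ≡ eval p x - eval q x
eval-- p q x = trans (eval-+ p _ x) (trans (cong (λ a → eval p x + a) (eval-• (- 1ℚ) q x))
  (solve 2 (λ a b → a :+ (:- con 1ℚ) :* b := a :- b) refl (eval p x) (eval q x)))

eval-* : ∀ p q x → eval (p *ᵖ q) x ≡ eval p x * eval q x
eval-* []      q x = sym (ℚ.*-zeroˡ (eval q x))
eval-* (a ∷ p) q x = begin
  eval (a • q +ᵖ (0ℚ ∷ p *ᵖ q)) x                  ≡⟨ eval-+ (a • q) (0ℚ ∷ p *ᵖ q) x ⟩
  eval (a • q) x + (0ℚ + x * eval (p *ᵖ q) x)      ≡⟨ cong₂ (λ s t → s + (0ℚ + x * t)) (eval-• a q x) (eval-* p q x) ⟩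
  a * eval q x + (0ℚ + x * (eval p x * eval q x))
    ≡⟨ solve 4 (λ a x u v → a :* v :+ (con 0ℚ :+ x :* (u :* v)) := (a :+ x :* u) :* v) refl a x (eval p x) (eval q x) ⟩
  (a + x * eval p x) * eval q x                    ∎

eval-con : ∀ a x → eval (a ∷ []) x ≡ a
eval-con a x = solve 2 (λ a x → a :+ x :* con 0ℚ := a) refl a x

eval-^ : ∀ p n x → eval (p ^ᵖ n) x ≡ eval p x ^ n
eval-^ p zero    x = eval-con 1ℚ x
eval-^ p (suc n) x = trans (eval-* p (p ^ᵖ n) x) (cong (eval p x *_) (eval-^ p n x))

eval-z : ∀ x → eval z x ≡ x
eval-z x = solve 1 (λ x → con 0ℚ :+ x :* (con 1ℚ :+ x :* con 0ℚ) := x) refl x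

eval-z-1 : ∀ x → eval (z -ᵖ 1ᵖ) x ≡ x - 1ℚ
eval-z-1 x = trans (eval-- z 1ᵖ x) (cong₂ _-_ (eval-z x) (eval-con 1ℚ x))

eval-⟨⟩ : ∀ p q x → eval (p ⟨ q ⟩ᵖ) x ≡ eval p (eval q x)
eval-⟨⟩ []      q x = refl
eval-⟨⟩ (a ∷ p) q x = begin
  eval ((a ∷ []) +ᵖ q *ᵖ p ⟨ q ⟩ᵖ) x              ≡⟨ eval-+ (a ∷ []) (q *ᵖ p ⟨ q ⟩ᵖ) x ⟩
  eval (a ∷ []) x + eval (q *ᵖ p ⟨ q ⟩ᵖ) x        ≡⟨ cong₂ _+_ (eval-con a x) (eval-* q _ x) ⟩
  a + eval q x * eval (p ⟨ q ⟩ᵖ) x                ≡⟨ cong (λ b → a + eval q x * b) (eval-⟨⟩ p q x) ⟩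
  a + eval q x * eval p (eval q x)                ∎

eval-applyUpTo : ∀ f n x → eval (sumᵖ (applyUpTo f n)) x ≡ ∑ n (λ i → eval (f i) x)
eval-applyUpTo f zero    x = refl
eval-applyUpTo f (suc n) x = trans (eval-+ (f 0) _ x) (cong (λ a → eval (f 0) x + a) (eval-applyUpTo (f ∘ suc) n x))

eval-tabulate : ∀ n f x → eval (sumᵖ (tabulate {n = n} (f ∘ toℕ))) x ≡ ∑ n (λ i → eval (f i) x)
eval-tabulate zero    f x = refl
eval-tabulate (suc n) f x = trans (eval-+ (f 0) _ x) (cong (λ a → eval (f 0) x + a) (eval-tabulate n (f ∘ suc) x))

-- (z p(z) − c p(c)) / (z − c)
quotient : ℚ → Poly → Poly
quotient c []      = []
quotient c (b ∷ p) = eval (b ∷ p) c ∷ quotient c p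

eval-quotient : ∀ c p x → (x - c) * eval (quotient c p) x ≡ x * eval p x - c * eval p c
eval-quotient c []      x = solve 2 (λ x c → (x :- c) :* con 0ℚ := x :* con 0ℚ :- c :* con 0ℚ) refl x c
eval-quotient c (b ∷ p) x = begin
  (x - c) * (b + c * v + x * eval (quotient c p) x)
    ≡⟨ solve 5 (λ x c b v w → (x :- c) :* (b :+ c :* v :+ x :* w) := (x :- c) :* (b :+ c :* v) :+ x :* ((x :- c) :* w)) refl
         x c b v (eval (quotient c p) x) ⟩
  (x - c) * (b + c * v) + x * ((x - c) * eval (quotient c p) x)
    ≡⟨ cong (λ a → (x - c) * (b + c * v) + x * a) (eval-quotient c p x) ⟩
  (x - c) * (b + c * v) + x * (x * u - c * v)
    ≡⟨ solve 5 (λ x c b u v → (x :- c) :* (b :+ c :* v) :+ x :* (x :* u :- c :* v) := x :* (b :+ x :* u) :- c :* (b :+ c :* v)) refl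
         x c b u v ⟩
  x * (b + x * u) - c * (b + c * v) ∎
  where
  u = eval p x
  v = eval p c

eval-≈0 : ∀ p x → p ≈ᵖ 0ᵖ → eval p x ≡ 0ℚ
eval-≈0 []      x p≈0 = refl
eval-≈0 (a ∷ p) x p≈0 = trans (cong₂ (λ a b → a + x * b) (p≈0 0) (eval-≈0 p x (p≈0 ∘ suc)))
  (solve 1 (λ x → con 0ℚ :+ x :* con 0ℚ := con 0ℚ) refl x)

cancel-constant : ∀ {a} x {b} → b ≡ 0ℚ → a + x * b ≡ 0ℚ → a ≡ 0ℚ
cancel-constant {a} x refl eq = trans (solve 2 (λ a x → a := a :+ x :* con 0ℚ) refl a x) eq

-- The coefficients of the quotient are the Horner values at c of the successive tails of p. Once a
-- tail vanishes, so does its value at c, and the next coefficient of the quotient reduces to the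
-- head of p.
quotient-≈0 : ∀ c p → quotient c p ≈ᵖ 0ᵖ → p ≈ᵖ 0ᵖ
quotient-≈0 c []      q≈0 i       = refl
quotient-≈0 c (b ∷ p) q≈0 (suc i) = quotient-≈0 c p (q≈0 ∘ suc) i
quotient-≈0 c (b ∷ p) q≈0 zero    = cancel-constant c (eval-≈0 p c (quotient-≈0 c p (q≈0 ∘ suc))) (q≈0 0)

-- Dividing by z - m leaves a polynomial that vanishes at m + 1, m + 2, ...; hence the starting
-- point m is part of the induction. The quotient is no sublist of p, so the induction runs on a
-- bound for the length.
≈0-from-ℕ : ∀ p m → (∀ n → eval p (fromℕ (m ℕ.+ n)) ≡ 0ℚ) → p ≈ᵖ 0ᵖ
≈0-from-ℕ p m = bounded (length p) p ℕ.≤-refl m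
  where
  length-quotient : ∀ c p → length (quotient c p) ≡ length p
  length-quotient c []      = refl
  length-quotient c (b ∷ p) = cong suc (length-quotient c p)

  bounded : ∀ l p → length p ≤ l → ∀ m → (∀ n → eval p (fromℕ (m ℕ.+ n)) ≡ 0ℚ) → p ≈ᵖ 0ᵖ
  bounded l       []      _         m zeros i = refl
  bounded (suc l) (a ∷ p) (s≤s p≤l) m zeros =
    λ where
      zero    → cancel-constant c (eval-≈0 p c p≈0) p[c]≡0
      (suc i) → p≈0 i
    where
    c = fromℕ m

    p[c]≡0 : eval (a ∷ p) c ≡ 0ℚ
    p[c]≡0 = trans (cong (λ k → eval (a ∷ p) (fromℕ k)) (sym (ℕ.+-identityʳ m))) (zeros 0)

    q-zeros : ∀ n → eval (quotient c p) (fromℕ (suc m ℕ.+ n)) ≡ 0ℚ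
    q-zeros n = begin
      -- The points m + 1 + n and m differ by n + 1, which is invertible; this moves the zeros of
      -- `a ∷ p` to the quotient.
      w                                    ≡⟨ ℚ.*-identityˡ w ⟨
      1ℚ * w                               ≡⟨ cong (_* w) (fromℕ-inverse (suc n)) ⟨
      fromℕ (suc n) * 1/1+ n * w           ≡⟨ solve 3 (λ d i w → d :* i :* w := i :* (d :* w)) refl (fromℕ (suc n)) (1/1+ n) w ⟩
      1/1+ n * (fromℕ (suc n) * w)         ≡⟨ cong (λ d → 1/1+ n * (d * w)) difference ⟩
      1/1+ n * ((x - c) * w)               ≡⟨ cong (1/1+ n *_) (eval-quotient c p x) ⟩
      1/1+ n * (x * eval p x - c * eval p c)
        ≡⟨ cong (1/1+ n *_) (solve 3 (λ a u v → u :- v := (a :+ u) :- (a :+ v)) refl a (x * eval p x) (c * eval p c)) ⟩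
      1/1+ n * (eval (a ∷ p) x - eval (a ∷ p) c) ≡⟨ cong₂ (λ u v → 1/1+ n * (u - v)) p[x]≡0 p[c]≡0 ⟩
      1/1+ n * (0ℚ - 0ℚ)                   ≡⟨ ℚ.*-zeroʳ (1/1+ n) ⟩
      0ℚ                                   ∎
      where
      x = fromℕ (suc m ℕ.+ n)
      w = eval (quotient c p) x
      p[x]≡0 : eval (a ∷ p) x ≡ 0ℚ
      p[x]≡0 = trans (cong (λ k → eval (a ∷ p) (fromℕ k)) (sym (ℕ.+-suc m n))) (zeros (suc n))
      difference : fromℕ (suc n) ≡ x - c
      difference = begin
        fromℕ (suc n)         ≡⟨ solve 2 (λ c d → d := c :+ d :- c) refl c (fromℕ (suc n)) ⟩
        c + fromℕ (suc n) - c ≡⟨ cong (_- c) (trans (cong fromℕ (sym (ℕ.+-suc m n))) (fromℕ-+ m (suc n))) ⟨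
        x - c                 ∎

    p≈0 : p ≈ᵖ 0ᵖ
    p≈0 = quotient-≈0 c p (bounded l (quotient c p) (subst (_≤ l) (sym (length-quotient c p)) p≤l) (suc m) q-zeros)

coeff-- : ∀ p q i → coeff (p -ᵖ q) i ≡ coeff p i - coeff q i
coeff-- p q i = trans (coeff-+ p _ i) (trans (cong (λ a → coeff p i + a) (coeff-• (- 1ℚ) q i))
  (solve 2 (λ a b → a :+ (:- con 1ℚ) :* b := a :- b) refl (coeff p i) (coeff q i)))
  where
  coeff-+ : ∀ p q i → coeff (p +ᵖ q) i ≡ coeff p i + coeff q i
  coeff-+ []      q       i       = sym (ℚ.+-identityˡ (coeff q i))
  coeff-+ (a ∷ p) []      i       = sym (ℚ.+-identityʳ _)
  coeff-+ (a ∷ p) (b ∷ q) zero    = refl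
  coeff-+ (a ∷ p) (b ∷ q) (suc i) = coeff-+ p q i

  coeff-• : ∀ a p i → coeff (a • p) i ≡ a * coeff p i
  coeff-• a []      i       = sym (ℚ.*-zeroʳ a)
  coeff-• a (b ∷ p) zero    = refl
  coeff-• a (b ∷ p) (suc i) = coeff-• a p i

≈ᵖ-from-eval : ∀ p q → (∀ x → eval p x ≡ eval q x) → p ≈ᵖ q
≈ᵖ-from-eval p q p≡q i = x∙y⁻¹≈ε⇒x≈y _ _
  (trans (sym (coeff-- p q i)) (≈0-from-ℕ (p -ᵖ q) 0 vanishes i))
  where
  vanishes : ∀ n → eval (p -ᵖ q) (fromℕ n) ≡ 0ℚ
  vanishes n = trans (eval-- p q (fromℕ n)) (x≈y⇒x∙y⁻¹≈ε (p≡q (fromℕ n)))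

-- Bernoulli polynomials

-- The coefficients of (e^t - 1)/t; those of t e^{xt}/(e^t - 1) are `β x`.
E : ℕ → ℚ
E n = 1/ suc n !

β : ℚ → ℕ → ℚ
β x n = eval (bernoulliPoly n) x * 1/ n !

eval-bernoulliPoly : ∀ n x → eval (bernoulliPoly n) x ≡
  x ^ n - 1/1+ n * ∑ n (λ i → fromℕ (suc n C i) * eval (bernoulliPoly i) x)
eval-bernoulliPoly n x = begin
  eval (bernoulliPoly n) x
    ≡⟨ cong (λ p → eval p x) (bernoulliPoly-unfold n) ⟩
  eval (z ^ᵖ n -ᵖ (1/1+ n) • rest) x
    ≡⟨ eval-- (z ^ᵖ n) ((1/1+ n) • rest) x ⟩
  eval (z ^ᵖ n) x - eval ((1/1+ n) • rest) x
    ≡⟨ cong₂ _-_ (trans (eval-^ z n x) (cong (_^ n) (eval-z x))) (eval-• (1/1+ n) rest x) ⟩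
  x ^ n - 1/1+ n * eval rest x
    ≡⟨ cong (λ a → x ^ n - 1/1+ n * a) (trans (eval-tabulate n term x)
         (∑-cong n λ i _ → eval-• (fromℕ (suc n C i)) (bernoulliPoly i) x)) ⟩
  x ^ n - 1/1+ n * ∑ n (λ i → fromℕ (suc n C i) * eval (bernoulliPoly i) x) ∎
  where
  term : ℕ → Poly
  term i = fromℕ (suc n C i) • bernoulliPoly i
  rest = sumᵖ (tabulate {n = n} (term ∘ toℕ))

-- The summand i = n is Bₙ(x)/n!. Unfolded there, the recursion gives xⁿ/n! minus exactly the
-- remaining summands.
β-⊛-E : ∀ x → β x ⊛ E ≗ exp x
β-⊛-E x n = begin
  (β x ⊛ E) n
    ≡⟨ trans (⊛-∑ (β x) E n) (∑-snoc n _) ⟩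
  ∑ n (λ i → β x i * E (n ∸ i)) + β x n * E (n ∸ n)
    ≡⟨ cong₂ _+_ (trans (∑-cong n term) (∑-* n (1/ suc n !) _))
         (cong₂ (λ b m → b * 1/ n ! * E m) (eval-bernoulliPoly n x) (ℕ.n∸n≡0 n)) ⟩
  1/ suc n ! * s + (x ^ n - 1/1+ n * s) * 1/ n ! * 1ℚ
    ≡⟨ cong (λ a → a * s + (x ^ n - 1/1+ n * s) * 1/ n ! * 1ℚ) (1/!-suc n) ⟩
  1/1+ n * 1/ n ! * s + (x ^ n - 1/1+ n * s) * 1/ n ! * 1ℚ
    ≡⟨ solve 4 (λ i f s p → i :* f :* s :+ (p :- i :* s) :* f :* con 1ℚ := p :* f) refl (1/1+ n) (1/ n !) s (x ^ n) ⟩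
  exp x n ∎
  where
  s = ∑ n (λ i → fromℕ (suc n C i) * eval (bernoulliPoly i) x)
  term : ∀ i → i < n → β x i * E (n ∸ i) ≡ 1/ suc n ! * (fromℕ (suc n C i) * eval (bernoulliPoly i) x)
  term i i<n = begin
    b * 1/ i ! * 1/ suc (n ∸ i) !
      ≡⟨ cong (λ m → b * 1/ i ! * 1/ m !) (ℕ.+-∸-assoc 1 (ℕ.<⇒≤ i<n)) ⟨
    b * 1/ i ! * 1/ (suc n ∸ i) !
      ≡⟨ ℚ.*-assoc b _ _ ⟩
    b * (1/ i ! * 1/ (suc n ∸ i) !)
      ≡⟨ cong (b *_) (C-factorials (ℕ.m≤n⇒m≤1+n (ℕ.<⇒≤ i<n))) ⟨
    b * (fromℕ (suc n C i) * 1/ suc n !)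
      ≡⟨ solve 3 (λ b c f → b :* (c :* f) := f :* (c :* b)) refl b (fromℕ (suc n C i)) (1/ suc n !) ⟩
    1/ suc n ! * (fromℕ (suc n C i) * b) ∎
    where b = eval (bernoulliPoly i) x

-- The way to recognise a sequence as `β x`: multiply by `E` and compare with an exponential.
β-unique : ∀ x f → f ⊛ E ≗ exp x → f ≗ β x
β-unique x f p = ⊛-cancelˡ E refl λ n → begin
  (E ⊛ f) n    ≡⟨ ⊛-comm E f n ⟩
  (f ⊛ E) n    ≡⟨ p n ⟩
  exp x n      ≡⟨ β-⊛-E x n ⟨
  (β x ⊛ E) n  ≡⟨ ⊛-comm (β x) E n ⟩
  (E ⊛ β x) n  ∎

β-+ : ∀ x y → β x ⊛ exp y ≗ β (x + y)
β-+ x y = β-unique (x + y) (β x ⊛ exp y) λ n → begin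
  (β x ⊛ exp y ⊛ E) n    ≡⟨ ⊛-assoc (β x) (exp y) E n ⟩
  (β x ⊛ (exp y ⊛ E)) n  ≡⟨ ⊛-cong (λ _ → refl) (⊛-comm (exp y) E) n ⟩
  (β x ⊛ (E ⊛ exp y)) n  ≡⟨ ⊛-assoc (β x) E (exp y) n ⟨
  (β x ⊛ E ⊛ exp y) n    ≡⟨ ⊛-cong (β-⊛-E x) (λ _ → refl) n ⟩
  (exp x ⊛ exp y) n      ≡⟨ exp-+ x y n ⟩
  exp (x + y) n          ∎

E-exp : ∀ n → exp 1ℚ (suc n) ≡ E n
E-exp n = trans (cong (_* E n) (1^ (suc n))) (ℚ.*-identityˡ (E n))

-- Since e^t = 1 + t(e^t - 1)/t, multiplying by e^t adds t times `β x ⊛ E`, that is, a shifted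
-- `exp x`.
β-diff : ∀ x n → β (x + 1ℚ) (suc n) ≡ β x (suc n) + exp x n
β-diff x n = begin
  β (x + 1ℚ) (suc n)                                    ≡⟨ β-+ x 1ℚ (suc n) ⟨
  (β x ⊛ exp 1ℚ) (suc n)                                ≡⟨ ⊛-suc (β x) (exp 1ℚ) n ⟩
  β x (suc n) * 1ℚ + (β x ⊛ exp 1ℚ ∘ suc) n
    ≡⟨ cong₂ _+_ (ℚ.*-identityʳ (β x (suc n))) (trans (⊛-cong (λ _ → refl) E-exp n) (β-⊛-E x n)) ⟩
  β x (suc n) + exp x n                                 ∎

exp-⊛-alt-E : exp 1ℚ ⊛ alt E ≗ E
exp-⊛-alt-E n = begin
  (exp 1ℚ ⊛ alt E) n
    ≡⟨ solve 2 (λ e a → a := e :- (e :* con 1ℚ :+ (:- con 1ℚ) :* a)) refl (E n) ((exp 1ℚ ⊛ alt E) n) ⟩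
  E n - (E n * 1ℚ + - 1ℚ * (exp 1ℚ ⊛ alt E) n)
    ≡⟨ cong (λ a → E n - a) (begin
         E n * 1ℚ + - 1ℚ * (exp 1ℚ ⊛ alt E) n
           ≡⟨ cong₂ (λ a b → a * 1ℚ + b) (E-exp n) shifted ⟨
         exp 1ℚ (suc n) * 1ℚ + (exp 1ℚ ⊛ exp (- 1ℚ) ∘ suc) n
           ≡⟨ ⊛-suc (exp 1ℚ) (exp (- 1ℚ)) n ⟨
         (exp 1ℚ ⊛ exp (- 1ℚ)) (suc n)
           ≡⟨ exp-+ 1ℚ (- 1ℚ) (suc n) ⟩
         exp 0ℚ (suc n)
           ≡⟨ exp-0 n ⟩
         0ℚ ∎) ⟩
  E n - 0ℚ
    ≡⟨ ℚ.+-identityʳ (E n) ⟩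
  E n ∎
  where
  shifted : (exp 1ℚ ⊛ exp (- 1ℚ) ∘ suc) n ≡ - 1ℚ * (exp 1ℚ ⊛ alt E) n
  shifted = begin
    (exp 1ℚ ⊛ exp (- 1ℚ) ∘ suc) n
      ≡⟨ ⊛-comm (exp 1ℚ) _ n ⟩
    (exp (- 1ℚ) ∘ suc ⊛ exp 1ℚ) n
      ≡⟨ ⊛-cong (λ i → trans (exp-neg (suc i)) (trans (alt-suc (exp 1ℚ) i)
           (cong (λ a → - 1ℚ * (sign i * a)) (E-exp i)))) (λ _ → refl) n ⟩
    ((λ i → - 1ℚ * alt E i) ⊛ exp 1ℚ) n
      ≡⟨ ⊛-*ˡ (- 1ℚ) (alt E) (exp 1ℚ) n ⟩
    - 1ℚ * (alt E ⊛ exp 1ℚ) n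
      ≡⟨ cong (- 1ℚ *_) (⊛-comm (alt E) (exp 1ℚ) n) ⟩
    - 1ℚ * (exp 1ℚ ⊛ alt E) n ∎

-- Replacing `E` by `alt E ⊛ exp 1ℚ` lets the two alternating factors combine to `alt (β 0ℚ ⊛ E)`.
-- This is `alt (exp 0ℚ)`, the unit sequence, and only `exp 1ℚ` remains.
β-reflect : alt (β 0ℚ) ≗ β 1ℚ
β-reflect = β-unique 1ℚ (alt (β 0ℚ)) λ n → begin
  (alt (β 0ℚ) ⊛ E) n                   ≡⟨ ⊛-cong (λ _ → refl) exp-⊛-alt-E n ⟨
  (alt (β 0ℚ) ⊛ (exp 1ℚ ⊛ alt E)) n    ≡⟨ ⊛-cong (λ _ → refl) (⊛-comm (exp 1ℚ) (alt E)) n ⟩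
  (alt (β 0ℚ) ⊛ (alt E ⊛ exp 1ℚ)) n    ≡⟨ ⊛-assoc (alt (β 0ℚ)) (alt E) (exp 1ℚ) n ⟨
  (alt (β 0ℚ) ⊛ alt E ⊛ exp 1ℚ) n      ≡⟨ ⊛-cong (λ i → trans (alt-⊛ (β 0ℚ) E i)
                                             (trans (cong (sign i *_) (β-⊛-E 0ℚ i)) (alt-exp-0 i))) (λ _ → refl) n ⟩
  (exp 0ℚ ⊛ exp 1ℚ) n                  ≡⟨ exp-0-⊛ (exp 1ℚ) n ⟩
  exp 1ℚ n                             ∎
  where
  alt-exp-0 : alt (exp 0ℚ) ≗ exp 0ℚ
  alt-exp-0 zero    = refl
  alt-exp-0 (suc n) = trans (cong (sign (suc n) *_) (exp-0 n)) (trans (ℚ.*-zeroʳ (sign (suc n))) (sym (exp-0 n)))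

β-Appell : ∀ x → β (x + 1ℚ) ≗ alt (β 0ℚ) ⊛ exp x
β-Appell x n = begin
  β (x + 1ℚ) n             ≡⟨ cong (λ y → β y n) (ℚ.+-comm x 1ℚ) ⟩
  β (1ℚ + x) n             ≡⟨ β-+ 1ℚ x n ⟨
  (β 1ℚ ⊛ exp x) n         ≡⟨ ⊛-cong β-reflect (λ _ → refl) n ⟨
  (alt (β 0ℚ) ⊛ exp x) n   ∎

β₀ : ∀ x → β x 0 ≡ 1ℚ
β₀ x = trans (sym (ℚ.*-identityʳ (β x 0))) (β-⊛-E x 0)

-- The source of the coefficient -1/2 in the recursion for ζ.
β₁ : β 0ℚ 1 ≡ - ½
β₁ = refl

-- The difference equation for ζ

-- Both sides are k (k − 1) ⋯ (k − q + 1).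
rising-neg : ∀ k q → q ≤ k → fromℕ (k !) * 1/ (k ∸ q) ! ≡ sign q * rising (- fromℕ k) q
rising-neg k zero    q≤k = !-inverse k
rising-neg k (suc q) q<k = begin
  fromℕ (k !) * 1/ m !
    ≡⟨ cong (fromℕ (k !) *_) (begin
         1/ m !                               ≡⟨ ℚ.*-identityˡ (1/ m !) ⟨
         1ℚ * 1/ m !                          ≡⟨ cong (_* 1/ m !) (fromℕ-inverse (suc m)) ⟨
         fromℕ (suc m) * 1/1+ m * 1/ m !      ≡⟨ ℚ.*-assoc (fromℕ (suc m)) (1/1+ m) (1/ m !) ⟩
         fromℕ (suc m) * (1/1+ m * 1/ m !)    ≡⟨ cong (fromℕ (suc m) *_) (1/!-suc m) ⟨
         fromℕ (suc m) * 1/ suc m !           ≡⟨ cong (λ l → fromℕ l * 1/ l !) (ℕ.+-∸-assoc 1 q<k) ⟨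
         fromℕ (k ∸ q) * 1/ (k ∸ q) !         ≡⟨ cong (_* 1/ (k ∸ q) !) (fromℕ-∸ q≤k) ⟩
         (fromℕ k - fromℕ q) * 1/ (k ∸ q) !   ∎) ⟩
  fromℕ (k !) * ((fromℕ k - fromℕ q) * 1/ (k ∸ q) !)
    ≡⟨ solve 4 (λ a k q f → a :* ((k :- q) :* f) := a :* f :* (k :- q)) refl (fromℕ (k !)) (fromℕ k) (fromℕ q) (1/ (k ∸ q) !) ⟩
  fromℕ (k !) * 1/ (k ∸ q) ! * (fromℕ k - fromℕ q)
    ≡⟨ cong (_* (fromℕ k - fromℕ q)) (rising-neg k q q≤k) ⟩
  sign q * rising (- fromℕ k) q * (fromℕ k - fromℕ q)
    ≡⟨ solve 4 (λ s r k q → s :* r :* (k :- q) := (:- s) :* (r :* (:- k :+ q))) refl (sign q) (rising (- fromℕ k) q) (fromℕ k) (fromℕ q) ⟩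
  sign (suc q) * rising (- fromℕ k) (suc q) ∎
  where
  m = k ∸ suc q
  q≤k = ℕ.<⇒≤ q<k

-- The recursion for ζ on values

zetaCoeff : ℕ → ℕ → ℚ
zetaCoeff k i = rising (- fromℕ k) (suc i) * bernoulli (suc (suc i)) * 1/ suc (suc i) !

-- The shorter ζ values are replaced by an arbitrary sequence g, so that the same step can be
-- applied to the powers of x that the difference equation introduces.
zetaStep : ℕ → ℕ → (ℕ → ℚ) → ℚ
zetaStep k j g = - (1/1+ k) * g (j ℕ.+ k ℕ.+ 1) + - ½ * g (j ℕ.+ k) + ∑ k (λ i → zetaCoeff k i * g (j ℕ.+ k ∸ suc i))

eval-zetaʳ-∷ : ∀ k j ks x → eval (zetaʳ k (j ∷ ks)) x ≡ zetaStep k j (λ m → eval (zetaʳ m ks) x)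
eval-zetaʳ-∷ k j ks x = trans (eval-+ (p +ᵖ q) (sumᵖ (applyUpTo r k)) x)
  (cong₂ _+_
    (trans (eval-+ p q x) (cong₂ _+_ (eval-• (- (1/1+ k)) (zetaʳ (j ℕ.+ k ℕ.+ 1) ks) x) (eval-• (- ½) (zetaʳ (j ℕ.+ k) ks) x)))
    (trans (eval-applyUpTo r k x) (∑-cong k λ i _ → eval-• (zetaCoeff k i) (zetaʳ (j ℕ.+ k ∸ suc i) ks) x)))
  where
  p = (- (1/1+ k)) • zetaʳ (j ℕ.+ k ℕ.+ 1) ks
  q = (- ½) • zetaʳ (j ℕ.+ k) ks
  r : ℕ → Poly
  r i = zetaCoeff k i • zetaʳ (j ℕ.+ k ∸ suc i) ks

-- The hypothesis has the shape of the difference equation, which thereby passes through one step of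
-- the recursion.
zetaStep-linear : ∀ k j a f g h → (∀ m → f m ≡ g m + a * h m) → zetaStep k j f ≡ zetaStep k j g + a * zetaStep k j h
zetaStep-linear k j a f g h p = begin
  u * f m + v * f n + ∑ k (λ i → zetaCoeff k i * f (l i))
    ≡⟨ cong₂ _+_ (cong₂ (λ x y → u * x + v * y) (p m) (p n)) sums ⟩
  u * (g m + a * h m) + v * (g n + a * h n) + (s + a * t)
    ≡⟨ solve 9 (λ u v a x x′ y y′ s t → u :* (x :+ a :* x′) :+ v :* (y :+ a :* y′) :+ (s :+ a :* t)
         := u :* x :+ v :* y :+ s :+ a :* (u :* x′ :+ v :* y′ :+ t)) refl u v a (g m) (h m) (g n) (h n) s t ⟩
  zetaStep k j g + a * zetaStep k j h ∎
  where
  u = - (1/1+ k)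
  v = - ½
  m = j ℕ.+ k ℕ.+ 1
  n = j ℕ.+ k
  l : ℕ → ℕ
  l i = j ℕ.+ k ∸ suc i
  s = ∑ k (λ i → zetaCoeff k i * g (l i))
  t = ∑ k (λ i → zetaCoeff k i * h (l i))
  sums : ∑ k (λ i → zetaCoeff k i * f (l i)) ≡ s + a * t
  sums = begin
    ∑ k (λ i → zetaCoeff k i * f (l i))
      ≡⟨ ∑-cong k (λ i _ → trans (cong (zetaCoeff k i *_) (p (l i)))
           (solve 4 (λ c x a y → c :* (x :+ a :* y) := c :* x :+ a :* (c :* y)) refl (zetaCoeff k i) (g (l i)) a (h (l i)))) ⟩
    ∑ k (λ i → zetaCoeff k i * g (l i) + a * (zetaCoeff k i * h (l i)))
      ≡⟨ ∑-+ k (λ i → zetaCoeff k i * g (l i)) (λ i → a * (zetaCoeff k i * h (l i))) ⟩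
    s + ∑ k (λ i → a * (zetaCoeff k i * h (l i)))
      ≡⟨ cong (λ b → s + b) (∑-* k a (λ i → zetaCoeff k i * h (l i))) ⟩
    s + a * t ∎

-- Every index at which the step reads its sequence contains the summand j; for i < k the truncated
-- subtraction takes nothing away from it.
zetaStep-^ : ∀ k j x → zetaStep k j (x ^_) ≡ x ^ j * zetaStep k 0 (x ^_)
zetaStep-^ k j x = begin
  u * x ^ (j ℕ.+ k ℕ.+ 1) + v * x ^ (j ℕ.+ k) + ∑ k (λ i → zetaCoeff k i * x ^ (j ℕ.+ k ∸ suc i))
    ≡⟨ cong₂ _+_ (cong₂ (λ a b → u * a + v * b)
         (trans (cong (x ^_) (ℕ.+-assoc j k 1)) (^-homo-* x j (k ℕ.+ 1))) (^-homo-* x j k)) sums ⟩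
  u * (c * x ^ (k ℕ.+ 1)) + v * (c * x ^ k) + c * s
    ≡⟨ solve 6 (λ u v c a b s → u :* (c :* a) :+ v :* (c :* b) :+ c :* s := c :* (u :* a :+ v :* b :+ s)) refl
         u v c (x ^ (k ℕ.+ 1)) (x ^ k) s ⟩
  c * zetaStep k 0 (x ^_) ∎
  where
  u = - (1/1+ k)
  v = - ½
  c = x ^ j
  s = ∑ k (λ i → zetaCoeff k i * x ^ (k ∸ suc i))
  sums : ∑ k (λ i → zetaCoeff k i * x ^ (j ℕ.+ k ∸ suc i)) ≡ c * s
  sums = trans (∑-cong k λ i i<k → trans
      (cong (zetaCoeff k i *_) (trans (cong (x ^_) (ℕ.+-∸-assoc j i<k)) (^-homo-* x j (k ∸ suc i))))
      (solve 3 (λ a b c → a :* (b :* c) := b :* (a :* c)) refl (zetaCoeff k i) c (x ^ (k ∸ suc i))))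
    (∑-* k c (λ i → zetaCoeff k i * x ^ (k ∸ suc i)))

eval-zetaʳ-[] : ∀ k x → eval (zetaʳ k []) x ≡ - (fromℕ (k !) * β x (suc k))
eval-zetaʳ-[] k x = trans (eval-• (- (1/1+ k)) (bernoulliPoly (suc k)) x) (begin
  - (1/1+ k) * b
    ≡⟨ solve 2 (λ i b → (:- i) :* b := :- (i :* b :* con 1ℚ)) refl (1/1+ k) b ⟩
  - (1/1+ k * b * 1ℚ)
    ≡⟨ cong (λ a → - (1/1+ k * b * a)) (!-inverse k) ⟨
  - (1/1+ k * b * (fromℕ (k !) * 1/ k !))
    ≡⟨ solve 4 (λ i b a f → :- (i :* b :* (a :* f)) := :- (a :* (b :* (i :* f)))) refl (1/1+ k) b (fromℕ (k !)) (1/ k !) ⟩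
  - (fromℕ (k !) * (b * (1/1+ k * 1/ k !)))
    ≡⟨ cong (λ a → - (fromℕ (k !) * (b * a))) (1/!-suc k) ⟨
  - (fromℕ (k !) * (b * 1/ suc k !)) ∎)
  where b = eval (bernoulliPoly (suc k)) x

eval-zetaʳ-[]-+1 : ∀ k x → eval (zetaʳ k []) (x + 1ℚ) ≡ eval (zetaʳ k []) x + - 1ℚ * x ^ k
eval-zetaʳ-[]-+1 k x = begin
  eval (zetaʳ k []) (x + 1ℚ)
    ≡⟨ eval-zetaʳ-[] k (x + 1ℚ) ⟩
  - (fromℕ (k !) * β (x + 1ℚ) (suc k))
    ≡⟨ cong (λ b → - (fromℕ (k !) * b)) (β-diff x k) ⟩
  - (fromℕ (k !) * (β x (suc k) + exp x k))
    ≡⟨ solve 3 (λ a b e → :- (a :* (b :+ e)) := :- (a :* b) :+ (:- con 1ℚ) :* (a :* e)) refl (fromℕ (k !)) (β x (suc k)) (exp x k) ⟩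
  - (fromℕ (k !) * β x (suc k)) + - 1ℚ * (fromℕ (k !) * exp x k)
    ≡⟨ cong₂ (λ a b → a + - 1ℚ * b) (sym (eval-zetaʳ-[] k x)) (factorial-exp k x) ⟩
  eval (zetaʳ k []) x + - 1ℚ * x ^ k ∎

-- The summands 0 and 1 of the Cauchy product in `β-Appell` at index k + 1 give the first two terms
-- of the step; summand i + 2 gives the term with q = i + 1.
zetaStep-^-0 : ∀ k x → zetaStep k 0 (x ^_) ≡ eval (zetaʳ k []) (x + 1ℚ)
zetaStep-^-0 k x = sym (begin
  eval (zetaʳ k []) (x + 1ℚ)
    ≡⟨ eval-zetaʳ-[] k (x + 1ℚ) ⟩
  - (a * β (x + 1ℚ) (suc k))
    ≡⟨ cong (λ b → - (a * b)) (trans (β-Appell x (suc k)) (⊛-∑ (alt (β 0ℚ)) (exp x) (suc k))) ⟩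
  - (a * (alt (β 0ℚ) 0 * exp x (suc k) + (alt (β 0ℚ) 1 * exp x k + s)))
    ≡⟨ cong₂ (λ b c → - (a * (b * exp x (suc k) + (c * exp x k + s))))
         (cong (1ℚ *_) (β₀ 0ℚ)) (cong (- 1ℚ *_) β₁) ⟩
  - (a * (1ℚ * (x * x ^ k * 1/ suc k !) + (½ * exp x k + s)))
    ≡⟨ cong (λ b → - (a * (1ℚ * (x * x ^ k * b) + (½ * exp x k + s)))) (1/!-suc k) ⟩
  - (a * (1ℚ * (x * x ^ k * (1/1+ k * 1/ k !)) + (½ * exp x k + s)))
    ≡⟨ solve 6 (λ a x p i f s → :- (a :* (con 1ℚ :* (x :* p :* (i :* f)) :+ (con ½ :* (p :* f) :+ s)))
         := (:- i) :* (x :* (a :* (p :* f))) :+ (:- con ½) :* (a :* (p :* f)) :+ (:- a) :* s) refl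
         a x (x ^ k) (1/1+ k) (1/ k !) s ⟩
  - (1/1+ k) * (x * (a * exp x k)) + - ½ * (a * exp x k) + - a * s
    ≡⟨ cong₂ (λ b c → - (1/1+ k) * (x * b) + - ½ * b + c) (factorial-exp k x)
         (trans (sym (∑-* k (- a) _)) (∑-cong k term)) ⟩
  - (1/1+ k) * (x ^ suc k) + - ½ * x ^ k + ∑ k (λ i → zetaCoeff k i * x ^ (k ∸ suc i))
    ≡⟨ cong (λ m → - (1/1+ k) * (x ^ m) + - ½ * x ^ k + ∑ k (λ i → zetaCoeff k i * x ^ (k ∸ suc i))) (ℕ.+-comm 1 k) ⟩
  zetaStep k 0 (x ^_) ∎)
  where
  a = fromℕ (k !)
  s = ∑ k (λ i → alt (β 0ℚ) (suc (suc i)) * exp x (k ∸ suc i))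
  term : ∀ i → i < k → - a * (alt (β 0ℚ) (suc (suc i)) * exp x (k ∸ suc i)) ≡ zetaCoeff k i * x ^ (k ∸ suc i)
  term i i<k = begin
    - a * (- σ * (b * f) * (p * g))
      ≡⟨ solve 6 (λ a s b f p g → (:- a) :* ((:- s) :* (b :* f) :* (p :* g)) := s :* (b :* f) :* p :* (a :* g)) refl a σ b f p g ⟩
    σ * (b * f) * p * (a * g)
      ≡⟨ cong (σ * (b * f) * p *_) (rising-neg k (suc i) i<k) ⟩
    σ * (b * f) * p * (σ * r)
      ≡⟨ solve 5 (λ s b f p r → s :* (b :* f) :* p :* (s :* r) := s :* s :* (r :* b :* f :* p)) refl σ b f p r ⟩
    -- One sign comes from the reflected Bernoulli numbers, the other from the rising factorial.
    σ * σ * (r * b * f * p)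
      ≡⟨ cong (_* (r * b * f * p)) (sign-square (suc i)) ⟩
    1ℚ * (r * b * f * p)
      ≡⟨ ℚ.*-identityˡ _ ⟩
    r * b * f * p ∎
    where
    σ = sign (suc i)
    b = bernoulli (suc (suc i))
    f = 1/ suc (suc i) !
    p = x ^ (k ∸ suc i)
    g = 1/ (k ∸ suc i) !
    r = rising (- fromℕ k) (suc i)

-- The lists are reversed, so n is the first letter of the word. While another letter precedes it in
-- the list, the recursion leaves n alone and the factor -xⁿ passes through by linearity. The
-- induction hypothesis is needed at every merged letter m, so k stays general.
eval-zetaʳ-∷ʳ-+1 : ∀ ks k n x →
  eval (zetaʳ k (ks ∷ʳ n)) (x + 1ℚ) ≡ eval (zetaʳ k (ks ∷ʳ n)) x + - (x ^ n) * eval (zetaʳ k ks) (x + 1ℚ)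
eval-zetaʳ-∷ʳ-+1 [] k n x = begin
  eval (zetaʳ k (n ∷ [])) (x + 1ℚ)
    ≡⟨ eval-zetaʳ-∷ k n [] (x + 1ℚ) ⟩
  zetaStep k n (λ m → eval (zetaʳ m []) (x + 1ℚ))
    -- Here the recursion merges k into n, so the correction is a step applied to the powers of x;
    -- the next line collapses it to xⁿ times a ζ value at x + 1.
    ≡⟨ zetaStep-linear k n (- 1ℚ) _ (λ m → eval (zetaʳ m []) x) (x ^_) (λ m → eval-zetaʳ-[]-+1 m x) ⟩
  zetaStep k n (λ m → eval (zetaʳ m []) x) + - 1ℚ * zetaStep k n (x ^_)
    ≡⟨ cong₂ (λ a b → a + - 1ℚ * b) (sym (eval-zetaʳ-∷ k n [] x))
         (trans (zetaStep-^ k n x) (cong (x ^ n *_) (zetaStep-^-0 k x))) ⟩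
  eval (zetaʳ k (n ∷ [])) x + - 1ℚ * (x ^ n * eval (zetaʳ k []) (x + 1ℚ))
    ≡⟨ cong (λ a → eval (zetaʳ k (n ∷ [])) x + a)
         (solve 2 (λ p e → (:- con 1ℚ) :* (p :* e) := (:- p) :* e) refl (x ^ n) (eval (zetaʳ k []) (x + 1ℚ))) ⟩
  eval (zetaʳ k (n ∷ [])) x + - (x ^ n) * eval (zetaʳ k []) (x + 1ℚ) ∎
eval-zetaʳ-∷ʳ-+1 (j ∷ ks) k n x = begin
  eval (zetaʳ k (j ∷ ks ∷ʳ n)) (x + 1ℚ)
    ≡⟨ eval-zetaʳ-∷ k j (ks ∷ʳ n) (x + 1ℚ) ⟩
  zetaStep k j (λ m → eval (zetaʳ m (ks ∷ʳ n)) (x + 1ℚ))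
    ≡⟨ zetaStep-linear k j (- (x ^ n)) _ (λ m → eval (zetaʳ m (ks ∷ʳ n)) x) (λ m → eval (zetaʳ m ks) (x + 1ℚ)) (λ m → eval-zetaʳ-∷ʳ-+1 ks m n x) ⟩
  zetaStep k j (λ m → eval (zetaʳ m (ks ∷ʳ n)) x) + - (x ^ n) * zetaStep k j (λ m → eval (zetaʳ m ks) (x + 1ℚ))
    ≡⟨ cong₂ (λ a b → a + - (x ^ n) * b) (eval-zetaʳ-∷ k j (ks ∷ʳ n) x) (eval-zetaʳ-∷ k j ks (x + 1ℚ)) ⟨
  eval (zetaʳ k (j ∷ ks ∷ʳ n)) x + - (x ^ n) * eval (zetaʳ k (j ∷ ks)) (x + 1ℚ) ∎

eval-zeta-∷-+1 : ∀ n w x →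
  eval (zeta (n ∷ w)) (x + 1ℚ) ≡ eval (zeta (n ∷ w)) x + - (x ^ n) * eval (zeta w) (x + 1ℚ)
eval-zeta-∷-+1 n w x =
  subst (λ l → eval (f l) (x + 1ℚ) ≡ eval (f l) x + - (x ^ n) * eval (zeta w) (x + 1ℚ))
    (sym (unfold-reverse n w)) (on-reversed (reverse w))
  where
  -- `fromReversed` carries the argument of `zeta` as a parameter, so the instances for `n ∷ w` and
  -- `w` differ formally; splitting the reversed list makes both compute.
  f = Zeta.fromReversed (n ∷ w)
  on-reversed : ∀ l → eval (f (l ∷ʳ n)) (x + 1ℚ) ≡ eval (f (l ∷ʳ n)) x + - (x ^ n) * eval (Zeta.fromReversed w l) (x + 1ℚ)
  on-reversed []       = trans (eval-zetaʳ-[]-+1 n x) (cong (λ a → eval (zetaʳ n []) x + a)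
    (trans (solve 1 (λ p → (:- con 1ℚ) :* p := (:- p) :* con 1ℚ) refl (x ^ n))
      (cong (- (x ^ n) *_) (sym (eval-con 1ℚ (x + 1ℚ))))))
  on-reversed (k ∷ ks) = eval-zetaʳ-∷ʳ-+1 ks k n x

-- Series

-- Apart from the empty prefix, every prefix begins with n; stripping n turns the rest into a
-- product on the shorter word.
·-∷ : ∀ F G n w x → eval ((F · G) (n ∷ w)) x ≡ eval (F []) x * eval (G (n ∷ w)) x + eval (((F ∘ (n ∷_)) · G) w) x
·-∷ F G n w x = trans (eval-+ (F [] *ᵖ G (n ∷ w)) _ x)
  (cong₂ _+_ (eval-* (F []) (G (n ∷ w)) x) (cong (λ ps → eval (sumᵖ ps) x) (begin
    -- `zipWith-map` needs a `map` on both lists, hence the inserted identity.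
    zipWith _⊗_ (map (n ∷_) (inits w)) (tails w)           ≡⟨ cong (zipWith _⊗_ _) (map-id (tails w)) ⟨
    zipWith _⊗_ (map (n ∷_) (inits w)) (map id (tails w))  ≡⟨ zipWith-map _⊗_ (n ∷_) id (inits w) (tails w) ⟩
    zipWith (λ u v → F (n ∷ u) *ᵖ G v) (inits w) (tails w) ∎)))
  where
  _⊗_ : List ℕ → List ℕ → Poly
  u ⊗ v = F u *ᵖ G v

·-[] : ∀ F G x → eval ((F · G) []) x ≡ eval (F []) x * eval (G []) x
·-[] F G x = trans (eval-+ (F [] *ᵖ G []) [] x) (trans (ℚ.+-identityʳ _) (eval-* (F []) (G []) x))

·-zeroˡ : ∀ F G x → (∀ u → eval (F u) x ≡ 0ℚ) → ∀ w → eval ((F · G) w) x ≡ 0ℚ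
·-zeroˡ F G x F≡0 []      = trans (·-[] F G x) (trans (cong (_* eval (G []) x) (F≡0 [])) (ℚ.*-zeroˡ (eval (G []) x)))
·-zeroˡ F G x F≡0 (n ∷ w) = trans (·-∷ F G n w x)
  (cong₂ _+_ (trans (cong (_* eval (G (n ∷ w)) x) (F≡0 [])) (ℚ.*-zeroˡ (eval (G (n ∷ w)) x))) (·-zeroˡ (F ∘ (n ∷_)) G x (F≡0 ∘ (n ∷_)) w))

·-constantˡ : ∀ F G x → (∀ n u → eval (F (n ∷ u)) x ≡ 0ℚ) → ∀ w → eval ((F · G) w) x ≡ eval (F []) x * eval (G w) x
·-constantˡ F G x F≡0 []      = ·-[] F G x
·-constantˡ F G x F≡0 (n ∷ w) = trans (·-∷ F G n w x)
  (trans (cong (λ a → eval (F []) x * eval (G (n ∷ w)) x + a) (·-zeroˡ (F ∘ (n ∷_)) G x (F≡0 n) w)) (ℚ.+-identityʳ _))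

·-suffix : ∀ F G x → eval (F []) x ≡ 0ℚ → ∀ n w → eval ((F · G) (n ∷ w)) x ≡ eval (((F ∘ (n ∷_)) · G) w) x
·-suffix F G x F[]≡0 n w = trans (·-∷ F G n w x)
  (trans (cong (λ a → a * eval (G (n ∷ w)) x + s) F[]≡0)
    (solve 2 (λ g s → con 0ℚ :* g :+ s := s) refl (eval (G (n ∷ w)) x) s))
  where s = eval (((F ∘ (n ∷_)) · G) w) x

Y-·-conˢ : ∀ k p n u x → eval ((Y k · conˢ p) (n ∷ u)) x ≡ eval (Y k (n ∷ [])) x * eval (conˢ p u) x
Y-·-conˢ k p n u x = trans (·-suffix (Y k) (conˢ p) x refl n u)
  (·-constantˡ (Y k ∘ (n ∷_)) (conˢ p) x (λ _ _ → refl) u)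

-- `Y k · conˢ p` vanishes except on one-letter words, so only the prefix n contributes.
Y-·-conˢ-· : ∀ k p G n w x →
  eval ((Y k · conˢ p · G) (n ∷ w)) x ≡ eval (Y k (n ∷ [])) x * eval p x * eval (G w) x
Y-·-conˢ-· k p G n w x = trans (·-suffix F G x refl n w)
  (trans (·-constantˡ (F ∘ (n ∷_)) G x longer w) (cong (_* eval (G w) x) (Y-·-conˢ k p n [] x)))
  where
  F = Y k · conˢ p
  longer : ∀ m u → eval (F (n ∷ m ∷ u)) x ≡ 0ℚ
  longer m u = trans (Y-·-conˢ k p n (m ∷ u) x) (ℚ.*-zeroʳ (eval (Y k (n ∷ [])) x))

Y-diagonal : ∀ k x → eval (Y k (k ∷ [])) x ≡ 1ℚ
Y-diagonal k x with k ℕ.≟ k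
... | yes _  = eval-con 1ℚ x
... | no k≢k = contradiction refl k≢k

Y-off-diagonal : ∀ k n x → k ≢ n → eval (Y k (n ∷ [])) x ≡ 0ℚ
Y-off-diagonal k n x k≢n with n ℕ.≟ k
... | yes n≡k = contradiction (sym n≡k) k≢n
... | no _    = refl

-- Closed form of ∑ₖ Y₋ₖ pₖ G, the witness for both sums: the leading letter of the word selects the
-- one k that contributes.
leftMultiple : (ℕ → Poly) → Series → Series
leftMultiple p G []      = 0ᵖ
leftMultiple p G (n ∷ w) = p n *ᵖ G w

isSum-leftMultiple : ∀ p G → IsSum (λ k → Y k · conˢ (p k) · G) (leftMultiple p G)
isSum-leftMultiple p G [] = 0 , λ M _ → ≈ᵖ-from-eval (sumᵖ (applyUpTo (λ k → (Y k · conˢ (p k) · G) []) M)) 0ᵖ λ x →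
  trans (eval-applyUpTo (λ k → (Y k · conˢ (p k) · G) []) M x) (∑-zero M λ _ → refl)
-- A partial sum of M terms contains the index n exactly when n < M, hence the threshold `suc n`.
isSum-leftMultiple p G (n ∷ w) = suc n , λ M n<M → ≈ᵖ-from-eval (sumᵖ (applyUpTo (λ k → (Y k · conˢ (p k) · G) (n ∷ w)) M)) (p n *ᵖ G w) λ x → begin
  eval (sumᵖ (applyUpTo (λ k → (Y k · conˢ (p k) · G) (n ∷ w)) M)) x
    ≡⟨ eval-applyUpTo (λ k → (Y k · conˢ (p k) · G) (n ∷ w)) M x ⟩
  ∑ M (λ k → eval ((Y k · conˢ (p k) · G) (n ∷ w)) x)
    ≡⟨ ∑-single M n _ n<M (λ k k≢n → trans (Y-·-conˢ-· k (p k) G n w x)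
         (trans (cong (λ a → a * eval (p k) x * eval (G w) x) (Y-off-diagonal k n x k≢n))
           (solve 2 (λ a b → con 0ℚ :* a :* b := con 0ℚ) refl (eval (p k) x) (eval (G w) x)))) ⟩
  eval ((Y n · conˢ (p n) · G) (n ∷ w)) x
    ≡⟨ Y-·-conˢ-· n (p n) G n w x ⟩
  eval (Y n (n ∷ [])) x * eval (p n) x * eval (G w) x
    ≡⟨ cong (λ a → a * eval (p n) x * eval (G w) x) (Y-diagonal n x) ⟩
  1ℚ * eval (p n) x * eval (G w) x
    ≡⟨ cong (_* eval (G w) x) (ℚ.*-identityˡ (eval (p n) x)) ⟩
  eval (p n) x * eval (G w) x
    ≡⟨ eval-* (p n) (G w) x ⟨
  eval (p n *ᵖ G w) x ∎

-- Two polynomials one apart cover both forms of the equation: z - 1 and z for the backward one, z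
-- and z + 1 for the forward one.
eval-H_B-difference : ∀ a b → (∀ x → eval b x ≡ eval a x + 1ℚ) → ∀ w x →
  eval (H_B w) (eval b x) - eval (H_B w) (eval a x) ≡
  - eval (leftMultiple (a ^ᵖ_) (H_B ⟨ b ⟩) w) x
eval-H_B-difference a b b≡a+1 []      x = trans (cong₂ _-_ (eval-con 1ℚ (eval b x)) (eval-con 1ℚ (eval a x))) refl
eval-H_B-difference a b b≡a+1 (n ∷ w) x = begin
  eval (zeta (n ∷ w)) (eval b x) - v
    ≡⟨ cong (λ y → eval (zeta (n ∷ w)) y - v) (b≡a+1 x) ⟩
  eval (zeta (n ∷ w)) (y + 1ℚ) - v
    ≡⟨ cong (_- v) (eval-zeta-∷-+1 n w y) ⟩
  v + - (y ^ n) * eval (zeta w) (y + 1ℚ) - v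
    ≡⟨ solve 3 (λ v p h → v :+ (:- p) :* h :- v := :- (p :* h)) refl v (y ^ n) (eval (zeta w) (y + 1ℚ)) ⟩
  - (y ^ n * eval (zeta w) (y + 1ℚ))
    ≡⟨ cong₂ (λ s t → - (s * t)) (eval-^ a n x) (trans (eval-⟨⟩ (zeta w) b x) (cong (eval (zeta w)) (b≡a+1 x))) ⟨
  - (eval (a ^ᵖ n) x * eval (zeta w ⟨ b ⟩ᵖ) x)
    ≡⟨ cong -_ (eval-* (a ^ᵖ n) (zeta w ⟨ b ⟩ᵖ) x) ⟨
  - eval (a ^ᵖ n *ᵖ zeta w ⟨ b ⟩ᵖ) x ∎
  where
  y = eval a x
  v = eval (zeta (n ∷ w)) y

eval--ˢ : ∀ F w x → eval ((-ˢ F) w) x ≡ - eval (F w) x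
eval--ˢ F w x = trans (eval-• (- 1ℚ) (F w) x) (solve 1 (λ a → (:- con 1ℚ) :* a := :- a) refl (eval (F w) x))

leftMultiple-congʳ : ∀ p F G w x → (∀ u → eval (F u) x ≡ eval (G u) x) →
  eval (leftMultiple p F w) x ≡ eval (leftMultiple p G w) x
leftMultiple-congʳ p F G []      x F≡G = refl
leftMultiple-congʳ p F G (n ∷ w) x F≡G =
  trans (eval-* (p n) (F w) x) (trans (cong (eval (p n) x *_) (F≡G w)) (sym (eval-* (p n) (G w) x)))

theoremC :
    (∃[ S ] (IsSum (λ k → Y k · conˢ ((z -ᵖ 1ᵖ) ^ᵖ k) · H_B) S
             × D₋ H_B ≋ -ˢ S))
    ×
    (∃[ S ] (IsSum (λ k → Y k · conˢ (z ^ᵖ k) · H_B ⟨ z +ᵖ 1ᵖ ⟩) S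
             × H_B ⟨ z +ᵖ 1ᵖ ⟩ -ˢ H_B ≋ -ˢ S))
theoremC =
    (S₋ , isSum-leftMultiple ((z -ᵖ 1ᵖ) ^ᵖ_) H_B , λ w → ≈ᵖ-from-eval (D₋ H_B w) ((-ˢ S₋) w) (backward w))
  , (S₊ , isSum-leftMultiple (z ^ᵖ_) (H_B ⟨ z +ᵖ 1ᵖ ⟩)
    , λ w → ≈ᵖ-from-eval ((H_B ⟨ z +ᵖ 1ᵖ ⟩ -ˢ H_B) w) ((-ˢ S₊) w) (forward w))
  where
  S₋ = leftMultiple ((z -ᵖ 1ᵖ) ^ᵖ_) H_B
  S₊ = leftMultiple (z ^ᵖ_) (H_B ⟨ z +ᵖ 1ᵖ ⟩)

  z≡z-1+1 : ∀ x → eval z x ≡ eval (z -ᵖ 1ᵖ) x + 1ℚ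
  z≡z-1+1 x = begin
    eval z x                  ≡⟨ eval-z x ⟩
    x                         ≡⟨ solve 1 (λ x → x := x :- con 1ℚ :+ con 1ℚ) refl x ⟩
    x - 1ℚ + 1ℚ               ≡⟨ cong (_+ 1ℚ) (eval-z-1 x) ⟨
    eval (z -ᵖ 1ᵖ) x + 1ℚ     ∎

  z+1≡z+1 : ∀ x → eval (z +ᵖ 1ᵖ) x ≡ eval z x + 1ℚ
  z+1≡z+1 x = trans (eval-+ z 1ᵖ x) (cong (λ a → eval z x + a) (eval-con 1ℚ x))

  backward : ∀ w x → eval (D₋ H_B w) x ≡ eval ((-ˢ S₋) w) x
  backward w x = begin
    eval (zeta w -ᵖ zeta w ⟨ z -ᵖ 1ᵖ ⟩ᵖ) x
      ≡⟨ eval-- (zeta w) (zeta w ⟨ z -ᵖ 1ᵖ ⟩ᵖ) x ⟩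
    eval (zeta w) x - eval (zeta w ⟨ z -ᵖ 1ᵖ ⟩ᵖ) x
      ≡⟨ cong₂ (λ s t → eval (zeta w) s - t) (sym (eval-z x)) (eval-⟨⟩ (zeta w) (z -ᵖ 1ᵖ) x) ⟩
    eval (zeta w) (eval z x) - eval (zeta w) (eval (z -ᵖ 1ᵖ) x)
      ≡⟨ eval-H_B-difference (z -ᵖ 1ᵖ) z z≡z-1+1 w x ⟩
    - eval (leftMultiple ((z -ᵖ 1ᵖ) ^ᵖ_) (H_B ⟨ z ⟩) w) x
      -- Substituting z for z yields other coefficient lists in general, but the same values.
      ≡⟨ cong -_ (leftMultiple-congʳ ((z -ᵖ 1ᵖ) ^ᵖ_) (H_B ⟨ z ⟩) H_B w x
           (λ u → trans (eval-⟨⟩ (zeta u) z x) (cong (eval (zeta u)) (eval-z x)))) ⟩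
    - eval (S₋ w) x
      ≡⟨ eval--ˢ S₋ w x ⟨
    eval ((-ˢ S₋) w) x ∎

  forward : ∀ w x → eval ((H_B ⟨ z +ᵖ 1ᵖ ⟩ -ˢ H_B) w) x ≡ eval ((-ˢ S₊) w) x
  forward w x = begin
    eval (zeta w ⟨ z +ᵖ 1ᵖ ⟩ᵖ -ᵖ zeta w) x
      ≡⟨ eval-- (zeta w ⟨ z +ᵖ 1ᵖ ⟩ᵖ) (zeta w) x ⟩
    eval (zeta w ⟨ z +ᵖ 1ᵖ ⟩ᵖ) x - eval (zeta w) x
      ≡⟨ cong₂ (λ s t → s - eval (zeta w) t) (eval-⟨⟩ (zeta w) (z +ᵖ 1ᵖ) x) (sym (eval-z x)) ⟩
    eval (zeta w) (eval (z +ᵖ 1ᵖ) x) - eval (zeta w) (eval z x)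
      ≡⟨ eval-H_B-difference z (z +ᵖ 1ᵖ) z+1≡z+1 w x ⟩
    - eval (S₊ w) x
      ≡⟨ eval--ˢ S₊ w x ⟨
    eval ((-ˢ S₊) w) x ∎
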